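{- For any integers $n\ge 1$ and $m\ge 1$, the following three quantities are equal: (1) the number of self-dual Fishburn matrices of reduced size $n$ whose last column has sum $m$ and whose diagonal cells are all equal to zero; (2) the number of self-dual Fishburn matrices of reduced size $n$ whose last column has sum $m$ and whose diagonal cells are not all equal to zero; (3) the number of row-Fishburn matrices of size $n$ whose last column has sum $m$. Moreover, for integers $n,m,p,q$ with $p+q\ge 1$, the number of self-dual Fishburn matrices $M$ with $\mathrm{rs}(M)=n$, $\max(M)=m$, $\mathrm{dg}(M)=p$ and $\mathrm{iso}(M)=q$ is equal to the number of row-Fishburn matrices $N$ of size $n$ with $\max(N)=m$, $\min(N)=p$ and $\mathrm{iso}(N)=q$. All these equalities remain valid when all matrices involved are restricted to be primitive (entries in $\{0,1\}$).
   Context: A Fishburn matrix is an upper-triangular square matrix of nonnegative integers in which every row and every column contains a nonzero entry. A row-Fishburn matrix is an upper-triangular square matrix of nonnegative integers in which every row contains a nonzero entry. A matrix is primitive if all its entries are $0$ or $1$. The size of a matrix is the sum of its entries. Rows and columns of a $k\times k$ matrix are numbered $1,\dots,k$; the corner cell is $(1,k)$. A $k\times k$ matrix $M$ is self-dual if $M_{ij}=M_{k+1-j,k+1-i}$ for all $i,j$. A cell $(i,j)$ is a diagonal cell if $i+j=k+1$ and an SE-cell if $i+j>k+1$. Statistics: $\mathrm{iso}$ = value of the corner cell; $\min$ = sum of the first row excluding the corner cell; $\max$ = sum of the last column excluding the corner cell; $\mathrm{dg}$ = sum of the diagonal cells excluding the corner cell. The reduced size $\mathrm{rs}(M)$ of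 a self-dual Fishburn matrix is the sum of all its diagonal cells and SE-cells. -}

module Defs where

open import Data.Nat using (ℕ; zero; suc; _+_; _∸_; _≡ᵇ_; _<ᵇ_)
open import Data.Bool using (Bool; true; false; _∧_; _∨_; not; T; if_then_else_)
open import Data.Fin using (Fin; toℕ; opposite; fromℕ) renaming (zero to fzero; suc to fsuc)
open import Data.Vec using (Vec; lookup)
open import Data.Product using (Σ)

allF : ∀ {k} → (Fin k → Bool) → Bool
allF {zero}  f = true
allF {suc k} f = f fzero ∧ allF (λ i → f (fsuc i))

anyF : ∀ {k} → (Fin k → Bool) → Bool
anyF {zero}  f = false
anyF {suc k} f = f fzero ∨ anyF (λ i → f (fsuc i))

sumF : ∀ {k} → (Fin k → ℕ) → ℕ
sumF {zero}  f = 0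
sumF {suc k} f = f fzero + sumF (λ i → f (fsuc i))

-- k × k matrices of nonnegative integers; Fin index i stands for row/column i+1
Mat : ℕ → Set
Mat k = Vec (Vec ℕ k) k

entry : ∀ {k} → Mat k → Fin k → Fin k → ℕ
entry M i j = lookup (lookup M i) j

pos : ∀ {k} → Fin k → ℕ
pos i = suc (toℕ i)

nonzero : ℕ → Bool
nonzero n = not (n ≡ᵇ 0)

upperTriangular : ∀ {k} → Mat k → Bool
upperTriangular M = allF λ i → allF λ j → if pos j <ᵇ pos i then entry M i j ≡ᵇ 0 else true

everyRowNonzero : ∀ {k} → Mat k → Bool
everyRowNonzero M = allF λ i → anyF λ j → nonzero (entry M i j)

everyColNonzero : ∀ {k} → Mat k → Bool
everyColNonzero M = allF λ j → anyF λ i → nonzero (entry M i j)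

isFishburn : ∀ {k} → Mat k → Bool
isFishburn M = upperTriangular M ∧ everyRowNonzero M ∧ everyColNonzero M

isRowFishburn : ∀ {k} → Mat k → Bool
isRowFishburn M = upperTriangular M ∧ everyRowNonzero M

isPrimitive : ∀ {k} → Mat k → Bool
isPrimitive M = allF λ i → allF λ j → entry M i j <ᵇ 2

-- M_{ij} = M_{k+1-j, k+1-i}   (opposite i corresponds to k+1-pos i)
isSelfDual : ∀ {k} → Mat k → Bool
isSelfDual M = allF λ i → allF λ j → entry M i j ≡ᵇ entry M (opposite j) (opposite i)

size : ∀ {k} → Mat k → ℕ
size M = sumF λ i → sumF λ j → entry M i j

isDiagCell : ∀ {k} → Fin k → Fin k → Bool
isDiagCell {k} i j = (pos i + pos j) ≡ᵇ suc k

isSECell : ∀ {k} → Fin k → Fin k → Bool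
isSECell {k} i j = suc k <ᵇ (pos i + pos j)

rs : ∀ {k} → Mat k → ℕ
rs M = sumF λ i → sumF λ j → if isDiagCell i j ∨ isSECell i j then entry M i j else 0

allDiagZero : ∀ {k} → Mat k → Bool
allDiagZero M = allF λ i → allF λ j → if isDiagCell i j then entry M i j ≡ᵇ 0 else true

lastColSum : ∀ {k} → Mat k → ℕ
lastColSum {zero}  M = 0
lastColSum {suc k} M = sumF λ i → entry M i (fromℕ k)

-- statistics (all 0 on the empty 0×0 matrix, which has no corner cell)
iso : ∀ {k} → Mat k → ℕ
iso {zero}  M = 0
iso {suc k} M = entry M fzero (fromℕ k)

minStat : ∀ {k} → Mat k → ℕ
minStat {zero}  M = 0
minStat {suc k} M = (sumF λ j → entry M fzero j) ∸ iso M

maxStat : ∀ {k} → Mat k → ℕ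
maxStat {zero}  M = 0
maxStat {suc k} M = lastColSum M ∸ iso M

dg : ∀ {k} → Mat k → ℕ
dg M = (sumF λ i → sumF λ j → if isDiagCell i j then entry M i j else 0) ∸ iso M

primOK : Bool → ∀ {k} → Mat k → Bool
primOK true  M = isPrimitive M
primOK false M = true

Family : (∀ {k} → Mat k → Bool) → Set
Family P = Σ ℕ λ k → Σ (Mat k) λ M → T (P M)

SDdiagZero : Bool → ℕ → ℕ → ∀ {k} → Mat k → Bool
SDdiagZero prim n m M = isFishburn M ∧ isSelfDual M ∧ (rs M ≡ᵇ n) ∧ (lastColSum M ≡ᵇ m)
                        ∧ allDiagZero M ∧ primOK prim M

SDdiagNonzero : Bool → ℕ → ℕ → ∀ {k} → Mat k → Bool
SDdiagNonzero prim n m M = isFishburn M ∧ isSelfDual M ∧ (rs M ≡ᵇ n) ∧ (lastColSum M ≡ᵇ m)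
                           ∧ not (allDiagZero M) ∧ primOK prim M

RFlastCol : Bool → ℕ → ℕ → ∀ {k} → Mat k → Bool
RFlastCol prim n m M = isRowFishburn M ∧ (size M ≡ᵇ n) ∧ (lastColSum M ≡ᵇ m) ∧ primOK prim M

SDstats : Bool → ℕ → ℕ → ℕ → ℕ → ∀ {k} → Mat k → Bool
SDstats prim n m p q M = isFishburn M ∧ isSelfDual M ∧ (rs M ≡ᵇ n) ∧ (maxStat M ≡ᵇ m)
                         ∧ (dg M ≡ᵇ p) ∧ (iso M ≡ᵇ q) ∧ primOK prim M

RFstats : Bool → ℕ → ℕ → ℕ → ℕ → ∀ {k} → Mat k → Bool
RFstats prim n m p q M = isRowFishburn M ∧ (size M ≡ᵇ n) ∧ (maxStat M ≡ᵇ m)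
                         ∧ (minStat M ≡ᵇ p) ∧ (iso M ≡ᵇ q) ∧ primOK prim M

{-# OPTIONS --safe #-}

-- A matrix cell is a weighted set with a distinguished zero. Write X, D, U, Z for the
-- generating functions of the cell types (zero included), u = U - 1, and let S(U,Z) count
-- self-dual Fishburn matrices by their diagonal and SE-cells, with the corner in Z, the rest
-- of the last column in U, the rest of the diagonal in D and all other cells in X. Merging the
-- first two rows and the last two columns gives
--   S(U,Z) + u S(U,Z) = (UZ - 1) + u S(XU, DUZ),
-- where u S(U,Z) accounts for the matrices whose last but one column becomes zero. Let R(U,Z)
-- count row-Fishburn matrices with first row in D,...,D,Z, last column in U and other cells in
-- X, and let B(U) be the same with D = X and Z = U. Row by row, R and B are sums of products,
-- and R + B satisfies the same equation. The factor u raises the degree, so S = R + B follows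
-- by induction on the degree, cancelling finite sets. The summand B is the part of S with zero
-- diagonal.
module Submission where

open import Defs
open import Algebra.Bundles using (CommutativeMonoid)
import Algebra.Solver.CommutativeMonoid as CommutativeMonoidSolver
open import Data.Bool using (Bool; true; false; _∧_; _∨_; not; T; if_then_else_)
open import Data.Bool.Properties using (T-irrelevant; T?; T-∧; T-∨; ∨-identityʳ; ∨-zeroʳ)
open import Data.Empty using (⊥-elim)
open import Data.Fin using (Fin; toℕ; opposite; fromℕ; inject₁) renaming (zero to fzero; suc to fsuc)
open import Data.Fin.Properties using (toℕ-inject₁; toℕ-fromℕ; toℕ<n; opposite-involutive)
open import Data.List as List using (List; []; _∷_; _++_; map; concatMap; upTo; length; cartesianProduct; deduplicate)
open import Data.List.Membership.Propositional using (_∈_; lose)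
open import Data.List.Membership.Propositional.Properties using (∈-map⁺; ∈-++⁺ˡ; ∈-++⁺ʳ; ∈-concatMap⁺; ∈-upTo⁺; ∈-cartesianProduct⁺; ∈-deduplicate⁺; ∈-lookup)
open import Data.List.Membership.Propositional.Properties.WithK using (unique⇒irrelevant)
open import Data.List.Relation.Unary.Any using (here; there; index)
open import Data.List.Relation.Unary.Any.Properties using (lookup-index)
open import Data.List.Relation.Unary.Unique.DecPropositional.Properties using (deduplicate-!)
open import Data.Nat using (ℕ; zero; suc; _+_; _∸_; _≤_; _<_; z≤n; s≤s; _≡ᵇ_; _<ᵇ_)
open import Data.Nat.Induction using (<-rec)
open import Data.Nat.Properties using (+-assoc; +-comm; +-suc; +-identityʳ; +-0-commutativeMonoid; +-mono-≤; +-monoˡ-≤; m≤m+n; m≤n+m; m+n∸m≡n; m∸n+n≡m; n∸n≡0; +-∸-assoc; m+n≡0⇒m≡0; m+n≡0⇒n≡0; n≤0⇒n≡0; n≢0⇒n>0; m<n⇒n≢0; ≤-refl; ≤-trans; ≤-pred; ≤-irrelevant; ≤⇒≯; <⇒≢; <-asym; <-irrefl; <⇒<ᵇ; <ᵇ⇒<; ≡ᵇ⇒≡; ≡⇒≡ᵇ; _≟_)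
open import Data.Product using (Σ; ∃; _×_; _,_; proj₁; proj₂)
open import Data.Product.Properties using (≡-dec)
open import Data.Sum using (_⊎_; inj₁; inj₂)
open import Data.Sum.Function.Propositional using (_⊎-↔_)
import Data.Sum.Properties as Sum
open import Data.Unit using (⊤; tt)
open import Data.Vec as Vec using (Vec; []; _∷_; lookup; tabulate)
open import Data.Vec.Properties using (lookup-map; map-∘; map-id; map-cong; lookup∘tabulate; tabulate∘lookup; tabulate-cong)
open import Function using (_∘_; id)
open import Function.Bundles using (_↔_; Inverse; Equivalence; mk↔ₛ′)
open import Function.Properties.Inverse using (↔-refl; ↔-sym; ↔-trans)
open import Relation.Binary using (DecidableEquality)
open import Relation.Binary.PropositionalEquality using (_≡_; _≢_; refl; sym; trans; cong; cong₂; subst; subst₂; isEquivalence)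
open import Relation.Binary.PropositionalEquality.WithK using (≡-irrelevant)
open import Relation.Nullary using (¬_; Dec; yes; no)
open import Relation.Nullary.Decidable using (map′)

-- Bijections

-- A merge turns U into XU and Z into DUZ, so the equation can be iterated only if it is stated for
-- arbitrary cells; what the recursion asks of a cell is that nonzero contents have positive degree
-- and that each degree is finite. The term `u S(U,Z)` on the left is a subtraction in disguise: the
-- matrices it counts have to be removed, so the bijection arises by cancellation and not from a
-- direct rule.
--
-- A weight consists of the degree, max, dg (or min) and iso. The first row counted by R is nonzero,
-- so min + iso is at least 1 there, while no cell of B is counted by these two statistics. Hence
-- the weights with p + q at least 1 compare S with R, which is the refined equality, and those with
-- p = q = 0 compare S with B, which is the equality of (1) and (3). The equality of (2) and (3) is
-- the refined equality summed over all weights with given n and given last column sum.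

Irr : ∀ {A : Set} → (A → Set) → Set
Irr P = ∀ {a} (p q : P a) → p ≡ q

Σ-≡ : ∀ {A : Set} {P : A → Set} → Irr P → {x y : Σ A P} → proj₁ x ≡ proj₁ y → x ≡ y
Σ-≡ irr {a , p} {_ , q} refl = cong (a ,_) (irr p q)

subset-↔ : ∀ {A B : Set} {P : A → Set} {Q : B → Set} → Irr P → Irr Q →
  (f : A → B) (g : B → A) → (∀ a → P a → Q (f a)) → (∀ b → Q b → P (g b)) →
  (∀ b → Q b → f (g b) ≡ b) → (∀ a → P a → g (f a) ≡ a) → Σ A P ↔ Σ B Q
subset-↔ irrP irrQ f g fP gQ fg gf = mk↔ₛ′
  (λ (a , p) → f a , fP a p) (λ (b , q) → g b , gQ b q)
  (λ (b , q) → Σ-≡ irrQ (fg b q)) (λ (a , p) → Σ-≡ irrP (gf a p))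

Σ-cong-↔ : ∀ {A : Set} {P Q : A → Set} → (∀ a → P a ↔ Q a) → Σ A P ↔ Σ A Q
Σ-cong-↔ e = mk↔ₛ′
  (λ (a , p) → a , Inverse.to (e a) p) (λ (a , q) → a , Inverse.from (e a) q)
  (λ (a , q) → cong (a ,_) (Inverse.strictlyInverseˡ (e a) q))
  (λ (a , p) → cong (a ,_) (Inverse.strictlyInverseʳ (e a) p))

-- Deleting one point from both sides of a bijection: if a is sent to the deleted
-- point, send it to the image of the deleted point instead.
Detour : ∀ {A B : Set} → (A ⊎ ⊤ → B ⊎ ⊤) → A → B → Set
Detour f a b = (f (inj₁ a) ≡ inj₁ b) ⊎ ((f (inj₁ a) ≡ inj₂ tt) × (f (inj₂ tt) ≡ inj₁ b))

detour : ∀ {A B : Set} (e : (A ⊎ ⊤) ↔ (B ⊎ ⊤)) (a : A) → Σ B (Detour (Inverse.to e) a)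
detour e a with Inverse.to e (inj₁ a) in p
... | inj₁ b = b , inj₁ refl
... | inj₂ tt with Inverse.to e (inj₂ tt) in q
...   | inj₁ b = b , inj₂ (refl , refl)
-- Otherwise `a` and the deleted point would both go to the deleted point, against injectivity.
...   | inj₂ tt with () ← trans (sym (Inverse.strictlyInverseʳ e (inj₁ a)))
                  (trans (cong (Inverse.from e) (trans p (sym q))) (Inverse.strictlyInverseʳ e (inj₂ tt)))

detour-unique : ∀ {A B : Set} (f : A ⊎ ⊤ → B ⊎ ⊤) {a b b′} → Detour f a b → Detour f a b′ → b ≡ b′
detour-unique f (inj₁ p) (inj₁ q) with refl ← trans (sym p) q = refl
detour-unique f (inj₁ p) (inj₂ (q , _)) with () ← trans (sym p) q
detour-unique f (inj₂ (p , _)) (inj₁ q) with () ← trans (sym p) q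
detour-unique f (inj₂ (_ , p)) (inj₂ (_ , q)) with refl ← trans (sym p) q = refl

-- Inverting the bijection reverses the path from a through the deleted point to b. With
-- `detour-unique`, this makes the two detour maps mutually inverse.
detour-sym : ∀ {A B : Set} (e : (A ⊎ ⊤) ↔ (B ⊎ ⊤)) {a b} →
  Detour (Inverse.to e) a b → Detour (Inverse.from e) b a
detour-sym e (inj₁ p) = inj₁ (trans (cong (Inverse.from e) (sym p)) (Inverse.strictlyInverseʳ e _))
detour-sym e (inj₂ (p , q)) = inj₂
  ( trans (cong (Inverse.from e) (sym q)) (Inverse.strictlyInverseʳ e _)
  , trans (cong (Inverse.from e) (sym p)) (Inverse.strictlyInverseʳ e _))

⊎⊤-cancel : ∀ {A B : Set} → (A ⊎ ⊤) ↔ (B ⊎ ⊤) → A ↔ B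
⊎⊤-cancel e = mk↔ₛ′ (proj₁ ∘ detour e) (proj₁ ∘ detour e⁻¹)
  (λ b → detour-unique (Inverse.to e) (proj₂ (detour e _)) (detour-sym e⁻¹ (proj₂ (detour e⁻¹ b))))
  (λ a → detour-unique (Inverse.from e) (proj₂ (detour e⁻¹ _)) (detour-sym e (proj₂ (detour e a))))
  where e⁻¹ = ↔-sym e

⊎-Fin-suc : ∀ {A : Set} {n} → (A ⊎ Fin (suc n)) ↔ ((A ⊎ Fin n) ⊎ ⊤)
⊎-Fin-suc = mk↔ₛ′
  (λ { (inj₁ a) → inj₁ (inj₁ a) ; (inj₂ fzero) → inj₂ tt ; (inj₂ (fsuc i)) → inj₁ (inj₂ i) })
  (λ { (inj₁ (inj₁ a)) → inj₁ a ; (inj₁ (inj₂ i)) → inj₂ (fsuc i) ; (inj₂ tt) → inj₂ fzero })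
  (λ { (inj₁ (inj₁ a)) → refl ; (inj₁ (inj₂ i)) → refl ; (inj₂ tt) → refl })
  (λ { (inj₁ a) → refl ; (inj₂ fzero) → refl ; (inj₂ (fsuc i)) → refl })

⊎-identityʳ-↔ : ∀ {A E : Set} → ¬ E → (A ⊎ E) ↔ A
⊎-identityʳ-↔ ¬e = mk↔ₛ′ (λ { (inj₁ a) → a ; (inj₂ e) → ⊥-elim (¬e e) }) inj₁
  (λ _ → refl) (λ { (inj₁ a) → refl ; (inj₂ e) → ⊥-elim (¬e e) })

⊎-identityˡ-↔ : ∀ {A E : Set} → ¬ E → (E ⊎ A) ↔ A
⊎-identityˡ-↔ ¬e = mk↔ₛ′ (λ { (inj₂ a) → a ; (inj₁ e) → ⊥-elim (¬e e) }) inj₂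
  (λ _ → refl) (λ { (inj₂ a) → refl ; (inj₁ e) → ⊥-elim (¬e e) })

⊎-Fin-cancel : ∀ {A B : Set} n → (A ⊎ Fin n) ↔ (B ⊎ Fin n) → A ↔ B
⊎-Fin-cancel zero e = ↔-trans (↔-sym (⊎-identityʳ-↔ (λ ()))) (↔-trans e (⊎-identityʳ-↔ (λ ())))
⊎-Fin-cancel (suc n) e =
  ⊎-Fin-cancel n (⊎⊤-cancel (↔-trans (↔-sym ⊎-Fin-suc) (↔-trans e ⊎-Fin-suc)))

index-∈-lookup : ∀ {A : Set} (xs : List A) i → index (∈-lookup {xs = xs} i) ≡ i
index-∈-lookup (x ∷ xs) fzero    = refl
index-∈-lookup (x ∷ xs) (fsuc i) = cong fsuc (index-∈-lookup xs i)

-- Without duplicates a membership proof is unique, so the position in the list is a bijection.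
-- Lists with repetitions are thus good enough everywhere else.
listed⇒↔Fin : ∀ {C : Set} → DecidableEquality C → (xs : List C) → (∀ c → c ∈ xs) → ∃ λ n → C ↔ Fin n
listed⇒↔Fin {C} _≟C_ xs all = length ys , mk↔ₛ′ (index ∘ pos′) (List.lookup ys)
  (λ i → trans (cong index (unique⇒irrelevant (deduplicate-! _≟C_ xs) (pos′ (List.lookup ys i)) (∈-lookup i)))
               (index-∈-lookup ys i))
  (λ c → sym (lookup-index (pos′ c)))
  where
  ys = deduplicate _≟C_ xs
  pos′ : ∀ c → c ∈ ys
  pos′ c = ∈-deduplicate⁺ _≟C_ (all c)

⊎-cancel : ∀ {A B C : Set} → DecidableEquality C → (xs : List C) → (∀ c → c ∈ xs) →
  (A ⊎ C) ↔ (B ⊎ C) → A ↔ B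
⊎-cancel _≟C_ xs all e with n , c ← listed⇒↔Fin _≟C_ xs all =
  ⊎-Fin-cancel n (↔-trans (↔-refl ⊎-↔ ↔-sym c) (↔-trans e (↔-refl ⊎-↔ c)))

sift : ∀ {A : Set} {P : A → Set} → (∀ a → Dec (P a)) → List A → List (Σ A P)
sift P? [] = []
sift P? (a ∷ as) with P? a
... | yes p = (a , p) ∷ sift P? as
... | no _  = sift P? as

∈-sift : ∀ {A : Set} {P : A → Set} (P? : ∀ a → Dec (P a)) → Irr P →
  ∀ {a as} (p : P a) → a ∈ as → (a , p) ∈ sift P? as
∈-sift P? irr {a} p (here refl) with P? a
... | yes q = here (cong (a ,_) (irr p q))
... | no ¬p = ⊥-elim (¬p p)
∈-sift P? irr {as = b ∷ _} p (there a∈) with P? b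
... | yes _ = there (∈-sift P? irr p a∈)
... | no _  = ∈-sift P? irr p a∈

-- Weights

-- The four coordinates are the (reduced) size, max, dg or min, and iso.
Wt : Set
Wt = ℕ × ℕ × ℕ × ℕ

deg st₂ st₃ st₄ : Wt → ℕ
deg (a , _) = a
st₂ (_ , b , _) = b
st₃ (_ , _ , c , _) = c
st₄ (_ , _ , _ , d) = d

infixr 6 _⊕_
_⊕_ : Wt → Wt → Wt
v ⊕ w = deg v + deg w , st₂ v + st₂ w , st₃ v + st₃ w , st₄ v + st₄ w

𝟘 : Wt
𝟘 = 0 , 0 , 0 , 0

Wt-≡ : ∀ {a a′ b b′ c c′ d d′ : ℕ} → a ≡ a′ → b ≡ b′ → c ≡ c′ → d ≡ d′ →
  _≡_ {A = Wt} (a , b , c , d) (a′ , b′ , c′ , d′)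
Wt-≡ refl refl refl refl = refl

Wt-commutativeMonoid : CommutativeMonoid _ _
Wt-commutativeMonoid = record
  { Carrier = Wt ; _≈_ = _≡_ ; _∙_ = _⊕_ ; ε = 𝟘
  ; isCommutativeMonoid = record
    { isMonoid = record
      { isSemigroup = record
        { isMagma = record { isEquivalence = isEquivalence ; ∙-cong = cong₂ _⊕_ }
        ; assoc = λ u v w → Wt-≡ (+-assoc (deg u) _ _) (+-assoc (st₂ u) _ _) (+-assoc (st₃ u) _ _) (+-assoc (st₄ u) _ _) }
      ; identity = (λ _ → refl) , λ w → Wt-≡ (+-identityʳ _) (+-identityʳ _) (+-identityʳ _) (+-identityʳ _) }
    ; comm = λ v w → Wt-≡ (+-comm (deg v) _) (+-comm (st₂ v) _) (+-comm (st₃ v) _) (+-comm (st₄ v) _) } }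

open CommutativeMonoid Wt-commutativeMonoid using ()
  renaming (assoc to ⊕-assoc; comm to ⊕-comm; identityʳ to ⊕-identityʳ)
module ⊕-Solver = CommutativeMonoidSolver Wt-commutativeMonoid

⊕-swap : ∀ a b c → a ⊕ (b ⊕ c) ≡ b ⊕ (a ⊕ c)
⊕-swap a b c = trans (sym (⊕-assoc a b c)) (trans (cong (_⊕ c) (⊕-comm a b)) (⊕-assoc b a c))

_≟W_ : DecidableEquality Wt
_≟W_ = ≡-dec _≟_ (≡-dec _≟_ (≡-dec _≟_ _≟_))

-- Weighted types

-- Without eta, and with the operations given by copatterns, an application such as
-- A ×ʷ B is stuck, which lets unification recover A and B from it.
record Weighted : Set₁ where
  no-eta-equality
  field
    Car : Set
    wt  : Car → Wt
open Weighted

infix 0 _≅_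
record _≅_ (A B : Weighted) : Set where
  field
    to      : Car A → Car B
    from    : Car B → Car A
    to-from : ∀ b → to (from b) ≡ b
    from-to : ∀ a → from (to a) ≡ a
    wt-to   : ∀ a → wt B (to a) ≡ wt A a
open _≅_

≅-refl : ∀ {A} → A ≅ A
≅-refl = record { to = id ; from = id ; to-from = λ _ → refl ; from-to = λ _ → refl ; wt-to = λ _ → refl }

≅-sym : ∀ {A B} → A ≅ B → B ≅ A
≅-sym {A} {B} e = record { to = from e ; from = to e ; to-from = from-to e ; from-to = to-from e
  ; wt-to = λ b → trans (sym (wt-to e (from e b))) (cong (wt B) (to-from e b)) }

≅-trans : ∀ {A B C} → A ≅ B → B ≅ C → A ≅ C
≅-trans e f = record { to = to f ∘ to e ; from = from e ∘ from f
  ; to-from = λ c → trans (cong (to f) (to-from e _)) (to-from f c)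
  ; from-to = λ a → trans (cong (from e) (from-to f _)) (from-to e a)
  ; wt-to = λ a → trans (wt-to f _) (wt-to e a) }

infixr 1 _⊎ʷ_
infixr 2 _×ʷ_

_⊎ʷ_ _×ʷ_ : Weighted → Weighted → Weighted
Car (A ⊎ʷ B) = Car A ⊎ Car B
wt (A ⊎ʷ B) (inj₁ a) = wt A a
wt (A ⊎ʷ B) (inj₂ b) = wt B b
Car (A ×ʷ B) = Car A × Car B
wt (A ×ʷ B) (a , b) = wt A a ⊕ wt B b

𝟙ʷ : Weighted
Car 𝟙ʷ = ⊤
wt 𝟙ʷ _ = 𝟘

Σʷ : (ℕ → Weighted) → Weighted
Car (Σʷ A) = Σ ℕ (Car ∘ A)
wt (Σʷ A) (j , a) = wt (A j) a

subʷ : (A : Weighted) → (Car A → Bool) → Weighted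
Car (subʷ A P) = Σ (Car A) (T ∘ P)
wt (subʷ A P) (a , _) = wt A a

-- The set counted by the coefficient of `w` in the generating function of `A`.
_[_] : Weighted → Wt → Set
A [ w ] = Σ (Car A) λ a → wt A a ≡ w

⊎ʷ-cong : ∀ {A B C D} → A ≅ B → C ≅ D → A ⊎ʷ C ≅ B ⊎ʷ D
⊎ʷ-cong e f = record
  { to = λ { (inj₁ a) → inj₁ (to e a) ; (inj₂ c) → inj₂ (to f c) }
  ; from = λ { (inj₁ b) → inj₁ (from e b) ; (inj₂ d) → inj₂ (from f d) }
  ; to-from = λ { (inj₁ b) → cong inj₁ (to-from e b) ; (inj₂ d) → cong inj₂ (to-from f d) }
  ; from-to = λ { (inj₁ a) → cong inj₁ (from-to e a) ; (inj₂ c) → cong inj₂ (from-to f c) }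
  ; wt-to = λ { (inj₁ a) → wt-to e a ; (inj₂ c) → wt-to f c } }

×ʷ-cong : ∀ {A B C D} → A ≅ B → C ≅ D → A ×ʷ C ≅ B ×ʷ D
×ʷ-cong e f = record
  { to = λ (a , c) → to e a , to f c
  ; from = λ (b , d) → from e b , from f d
  ; to-from = λ (b , d) → cong₂ _,_ (to-from e b) (to-from f d)
  ; from-to = λ (a , c) → cong₂ _,_ (from-to e a) (from-to f c)
  ; wt-to = λ (a , c) → cong₂ _⊕_ (wt-to e a) (wt-to f c) }

Σʷ-cong : ∀ {A B} → (∀ j → A j ≅ B j) → Σʷ A ≅ Σʷ B
Σʷ-cong e = record
  { to = λ (j , a) → j , to (e j) a
  ; from = λ (j , b) → j , from (e j) b
  ; to-from = λ (j , b) → cong (j ,_) (to-from (e j) b)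
  ; from-to = λ (j , a) → cong (j ,_) (from-to (e j) a)
  ; wt-to = λ (j , a) → wt-to (e j) a }

×ʷ-identityʳ : ∀ {A} → A ×ʷ 𝟙ʷ ≅ A
×ʷ-identityʳ = record { to = proj₁ ; from = _, tt ; to-from = λ _ → refl ; from-to = λ _ → refl
  ; wt-to = λ _ → sym (⊕-identityʳ _) }

×ʷ-swap : ∀ {A B C} → A ×ʷ (B ×ʷ C) ≅ B ×ʷ (A ×ʷ C)
×ʷ-swap {A} {B} {C} = record
  { to = λ (a , b , c) → b , a , c ; from = λ (b , a , c) → a , b , c
  ; to-from = λ _ → refl ; from-to = λ _ → refl
  ; wt-to = λ (a , b , c) → ⊕-swap (wt B b) (wt A a) (wt C c) }

×ʷ-distribˡ : ∀ {A B C} → A ×ʷ (B ⊎ʷ C) ≅ (A ×ʷ B) ⊎ʷ (A ×ʷ C)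
×ʷ-distribˡ = record
  { to = λ { (a , inj₁ b) → inj₁ (a , b) ; (a , inj₂ c) → inj₂ (a , c) }
  ; from = λ { (inj₁ (a , b)) → a , inj₁ b ; (inj₂ (a , c)) → a , inj₂ c }
  ; to-from = λ { (inj₁ _) → refl ; (inj₂ _) → refl }
  ; from-to = λ { (_ , inj₁ _) → refl ; (_ , inj₂ _) → refl }
  ; wt-to = λ { (_ , inj₁ _) → refl ; (_ , inj₂ _) → refl } }

×ʷ-distribˡ-Σʷ : ∀ {A B} → A ×ʷ Σʷ B ≅ Σʷ (λ j → A ×ʷ B j)
×ʷ-distribˡ-Σʷ = record
  { to = λ (a , j , b) → j , a , b ; from = λ (j , a , b) → a , j , b
  ; to-from = λ _ → refl ; from-to = λ _ → refl ; wt-to = λ _ → refl }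

Σʷ-suc : ∀ {A} → Σʷ A ≅ A 0 ⊎ʷ Σʷ (A ∘ suc)
Σʷ-suc = record
  { to = λ { (zero , a) → inj₁ a ; (suc j , a) → inj₂ (j , a) }
  ; from = λ { (inj₁ a) → zero , a ; (inj₂ (j , a)) → suc j , a }
  ; to-from = λ { (inj₁ _) → refl ; (inj₂ _) → refl }
  ; from-to = λ { (zero , _) → refl ; (suc _ , _) → refl }
  ; wt-to = λ { (zero , _) → refl ; (suc _ , _) → refl } }

Σʷ-⊎ʷ : ∀ {A B} → Σʷ (λ j → A j ⊎ʷ B j) ≅ Σʷ A ⊎ʷ Σʷ B
Σʷ-⊎ʷ = record
  { to = λ { (j , inj₁ a) → inj₁ (j , a) ; (j , inj₂ b) → inj₂ (j , b) }
  ; from = λ { (inj₁ (j , a)) → j , inj₁ a ; (inj₂ (j , b)) → j , inj₂ b }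
  ; to-from = λ { (inj₁ _) → refl ; (inj₂ _) → refl }
  ; from-to = λ { (_ , inj₁ _) → refl ; (_ , inj₂ _) → refl }
  ; wt-to = λ { (_ , inj₁ _) → refl ; (_ , inj₂ _) → refl } }

⊎ʷ-assoc : ∀ {A B C} → (A ⊎ʷ B) ⊎ʷ C ≅ A ⊎ʷ (B ⊎ʷ C)
⊎ʷ-assoc = record
  { to = λ { (inj₁ (inj₁ a)) → inj₁ a ; (inj₁ (inj₂ b)) → inj₂ (inj₁ b) ; (inj₂ c) → inj₂ (inj₂ c) }
  ; from = λ { (inj₁ a) → inj₁ (inj₁ a) ; (inj₂ (inj₁ b)) → inj₁ (inj₂ b) ; (inj₂ (inj₂ c)) → inj₂ c }
  ; to-from = λ { (inj₁ _) → refl ; (inj₂ (inj₁ _)) → refl ; (inj₂ (inj₂ _)) → refl }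
  ; from-to = λ { (inj₁ (inj₁ _)) → refl ; (inj₁ (inj₂ _)) → refl ; (inj₂ _) → refl }
  ; wt-to = λ { (inj₁ (inj₁ _)) → refl ; (inj₁ (inj₂ _)) → refl ; (inj₂ _) → refl } }

fibre-↔ : ∀ {A B} → A ≅ B → ∀ w → A [ w ] ↔ B [ w ]
fibre-↔ {A} {B} e w = subset-↔ ≡-irrelevant ≡-irrelevant (to e) (from e)
  (λ a p → trans (wt-to e a) p) (λ b q → trans (wt-to (≅-sym e) b) q)
  (λ b _ → to-from e b) (λ a _ → from-to e a)

fibre-⊎ : ∀ A B w → (A ⊎ʷ B) [ w ] ↔ (A [ w ] ⊎ B [ w ])
fibre-⊎ A B w = mk↔ₛ′
  (λ { (inj₁ a , p) → inj₁ (a , p) ; (inj₂ b , p) → inj₂ (b , p) })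
  (λ { (inj₁ (a , p)) → inj₁ a , p ; (inj₂ (b , p)) → inj₂ b , p })
  (λ { (inj₁ _) → refl ; (inj₂ _) → refl })
  (λ { (inj₁ _ , _) → refl ; (inj₂ _ , _) → refl })

-- Exposes the second factor as a fibre at its own weight `v`, the form in which an induction
-- hypothesis on weights applies to it.
fibre-× : ∀ A B w → (A ×ʷ B) [ w ] ↔ Σ (Car A) λ a → Σ (Σ Wt λ v → wt A a ⊕ v ≡ w) λ (v , _) → B [ v ]
fibre-× A B w = mk↔ₛ′
  (λ ((a , b) , p) → a , (wt B b , p) , b , refl)
  (λ (a , (v , p) , b , q) → (a , b) , trans (cong (wt A a ⊕_) q) p)
  (λ { (a , (v , p) , b , refl) → refl }) (λ { ((a , b) , refl) → refl })

-- Weighted types with finitely many elements of each degree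

record FinitelyGraded (A : Weighted) : Set where
  field
    dec     : DecidableEquality (Car A)
    upto    : ℕ → List (Car A)
    ∈-upto  : ∀ N a → deg (wt A a) ≤ N → a ∈ upto N
open FinitelyGraded

𝟙ʷ-fg : FinitelyGraded 𝟙ʷ
𝟙ʷ-fg = record { dec = λ _ _ → yes refl ; upto = λ _ → tt ∷ [] ; ∈-upto = λ _ _ _ → here refl }

subʷ-fg : ∀ {A} P → FinitelyGraded A → FinitelyGraded (subʷ A P)
subʷ-fg P f = record
  { dec = ≡-dec (dec f) (λ p q → yes (T-irrelevant p q))
  ; upto = λ N → sift (T? ∘ P) (upto f N)
  ; ∈-upto = λ N (a , p) a≤ → ∈-sift (T? ∘ P) T-irrelevant p (∈-upto f N a a≤) }

×ʷ-fg : ∀ {A B} → FinitelyGraded A → FinitelyGraded B → FinitelyGraded (A ×ʷ B)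
×ʷ-fg {A} {B} f g = record
  { dec = ≡-dec (dec f) (dec g)
  ; upto = λ N → cartesianProduct (upto f N) (upto g N)
  ; ∈-upto = λ N (a , b) ab≤ → ∈-cartesianProduct⁺
      (∈-upto f N a (≤-trans (m≤m+n (deg (wt A a)) _) ab≤)) (∈-upto g N b (≤-trans (m≤n+m _ (deg (wt A a))) ab≤)) }

⊎ʷ-fg : ∀ {A B} → FinitelyGraded A → FinitelyGraded B → FinitelyGraded (A ⊎ʷ B)
⊎ʷ-fg f g = record
  { dec = Sum.≡-dec (dec f) (dec g)
  ; upto = λ N → map inj₁ (upto f N) ++ map inj₂ (upto g N)
  ; ∈-upto = λ { N (inj₁ a) a≤ → ∈-++⁺ˡ (∈-map⁺ inj₁ (∈-upto f N a a≤))
               ; N (inj₂ b) b≤ → ∈-++⁺ʳ (map inj₁ (upto f N)) (∈-map⁺ inj₂ (∈-upto g N b b≤)) } }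

-- As the index is bounded by the degree, only the summands up to index N can contribute up to
-- degree N.
Σʷ-fg : ∀ {A} → (∀ j a → j ≤ deg (wt (A j) a)) → (∀ j → FinitelyGraded (A j)) → FinitelyGraded (Σʷ A)
Σʷ-fg j≤ f = record
  { dec = ≡-dec _≟_ (λ {j} → dec (f j))
  ; upto = λ N → concatMap (λ j → map (j ,_) (upto (f j) N)) (upTo (suc N))
  ; ∈-upto = λ N (j , a) a≤ → ∈-concatMap⁺ (λ j → map (j ,_) (upto (f j) N))
      (lose (∈-upTo⁺ (s≤s (≤-trans (j≤ j a) a≤))) (∈-map⁺ (j ,_) (∈-upto (f j) N a a≤))) }

fibre-cancel : ∀ {A B : Set} {C} → FinitelyGraded C → ∀ w → (A ⊎ C [ w ]) ↔ (B ⊎ C [ w ]) → A ↔ B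
fibre-cancel {C = C} f w = ⊎-cancel (≡-dec (dec f) (λ p q → yes (≡-irrelevant p q)))
  (sift (λ c → wt C c ≟W w) (upto f (deg w)))
  (λ { (c , refl) → ∈-sift _ ≡-irrelevant refl (∈-upto f _ c ≤-refl) })

-- Possible contents of a matrix cell

record Cell : Set₁ where
  no-eta-equality
  field
    typ      : Weighted
    nz       : Car typ → Bool
    0#       : Car typ
    nz-0#    : nz 0# ≡ false
    nz-false : ∀ a → nz a ≡ false → a ≡ 0#
    wt-0#    : wt typ 0# ≡ 𝟘
    deg-nz   : ∀ a → T (nz a) → 1 ≤ deg (wt typ a)
    fg       : FinitelyGraded typ
open Cell

El : Cell → Set
El A = Car (typ A)

-- The generating function `A - 1`; for `U` this is the factor u.
_⁺ : Cell → Weighted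
A ⁺ = subʷ (typ A) (nz A)

¬nz-0# : ∀ A → ¬ T (nz A (0# A))
¬nz-0# A p = subst T (nz-0# A) p

zero-or-nz : ∀ A a → (a ≡ 0# A) ⊎ T (nz A a)
zero-or-nz A a with nz A a in eq
... | true  = inj₂ tt
... | false = inj₁ (nz-false A a eq)

T-∨⁻ : ∀ {a b} → T (a ∨ b) → T a ⊎ T b
T-∨⁻ = Equivalence.to T-∨
T-∨⁺ : ∀ {a b} → T a ⊎ T b → T (a ∨ b)
T-∨⁺ = Equivalence.from T-∨
T-∧⁻ : ∀ {a b} → T (a ∧ b) → T a × T b
T-∧⁻ = Equivalence.to T-∧
T-∧⁺ : ∀ {a b} → T a → T b → T (a ∧ b)
T-∧⁺ p q = Equivalence.from T-∧ (p , q)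

∨-false : ∀ {a b} → a ∨ b ≡ false → a ≡ false × b ≡ false
∨-false {false} p = refl , p

infixr 7 _⊗_
-- Merging two cells: both contents are kept, generating functions multiply, and the result is zero
-- only if both are.
_⊗_ : Cell → Cell → Cell
typ (A ⊗ B) = typ A ×ʷ typ B
nz (A ⊗ B) (a , b) = nz A a ∨ nz B b
0# (A ⊗ B) = 0# A , 0# B
nz-0# (A ⊗ B) = cong₂ _∨_ (nz-0# A) (nz-0# B)
nz-false (A ⊗ B) (a , b) p = cong₂ _,_ (nz-false A a (proj₁ (∨-false p))) (nz-false B b (proj₂ (∨-false p)))
wt-0# (A ⊗ B) = cong₂ _⊕_ (wt-0# A) (wt-0# B)
deg-nz (A ⊗ B) (a , b) p with T-∨⁻ p
... | inj₁ q = ≤-trans (deg-nz A a q) (m≤m+n _ _)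
... | inj₂ q = ≤-trans (deg-nz B b q) (m≤n+m _ _)
fg (A ⊗ B) = ×ʷ-fg (fg A) (fg B)

infix 0 _≅ᶜ_
record _≅ᶜ_ (A B : Cell) : Set where
  field
    iso-typ : typ A ≅ typ B
    nz-to   : ∀ a → nz B (to iso-typ a) ≡ nz A a
open _≅ᶜ_

≅ᶜ-refl : ∀ {A} → A ≅ᶜ A
≅ᶜ-refl = record { iso-typ = ≅-refl ; nz-to = λ _ → refl }

≅ᶜ-trans : ∀ {A B C} → A ≅ᶜ B → B ≅ᶜ C → A ≅ᶜ C
≅ᶜ-trans e f = record { iso-typ = ≅-trans (iso-typ e) (iso-typ f)
  ; nz-to = λ a → trans (nz-to f _) (nz-to e a) }

≅ᶜ-sym : ∀ {A B} → A ≅ᶜ B → B ≅ᶜ A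
≅ᶜ-sym {B = B} e = record { iso-typ = ≅-sym (iso-typ e)
  ; nz-to = λ b → trans (sym (nz-to e (from (iso-typ e) b))) (cong (nz B) (to-from (iso-typ e) b)) }

⊗-cong : ∀ {A B C D} → A ≅ᶜ B → C ≅ᶜ D → A ⊗ C ≅ᶜ B ⊗ D
⊗-cong e f = record { iso-typ = ×ʷ-cong (iso-typ e) (iso-typ f)
  ; nz-to = λ (a , c) → cong₂ _∨_ (nz-to e a) (nz-to f c) }

⊗-swap : ∀ {A B C} → A ⊗ (B ⊗ C) ≅ᶜ B ⊗ (A ⊗ C)
⊗-swap {A} {B} {C} = record { iso-typ = ×ʷ-swap {typ A} {typ B} {typ C}
  ; nz-to = λ (a , b , c) → ∨-swap (nz B b) (nz A a) (nz C c) }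
  where
  ∨-swap : ∀ x y z → x ∨ (y ∨ z) ≡ y ∨ (x ∨ z)
  ∨-swap true  y z = sym (∨-zeroʳ y)
  ∨-swap false y z = refl

subʷ-cong : ∀ {A B P Q} (e : A ≅ B) → (∀ a → Q (to e a) ≡ P a) → subʷ A P ≅ subʷ B Q
subʷ-cong {Q = Q} e PQ = record
  { to = λ (a , p) → to e a , subst T (sym (PQ a)) p
  ; from = λ (b , q) → from e b , subst T (trans (cong Q (sym (to-from e b))) (PQ (from e b))) q
  ; to-from = λ (b , _) → Σ-≡ T-irrelevant (to-from e b)
  ; from-to = λ (a , _) → Σ-≡ T-irrelevant (from-to e a)
  ; wt-to = λ (a , _) → wt-to e a }

⁺-cong : ∀ {A B} → A ≅ᶜ B → A ⁺ ≅ B ⁺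
⁺-cong e = subʷ-cong (iso-typ e) (nz-to e)

typ-split : ∀ A → typ A ≅ A ⁺ ⊎ʷ 𝟙ʷ
typ-split A = record { to = λ a → f a (zero-or-nz A a) ; from = g ; to-from = fg′ ; from-to = λ a → gf a (zero-or-nz A a)
                     ; wt-to = λ a → w a (zero-or-nz A a) }
  where
  f : ∀ a → (a ≡ 0# A) ⊎ T (nz A a) → Car (A ⁺ ⊎ʷ 𝟙ʷ)
  f a (inj₁ _) = inj₂ tt
  f a (inj₂ p) = inj₁ (a , p)
  g : Car (A ⁺ ⊎ʷ 𝟙ʷ) → El A
  g (inj₁ (a , _)) = a
  g (inj₂ _) = 0# A
  fg′ : ∀ b → f (g b) (zero-or-nz A (g b)) ≡ b
  fg′ (inj₁ (a , p)) with zero-or-nz A a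
  ... | inj₁ refl = ⊥-elim (¬nz-0# A p)
  ... | inj₂ q = cong (λ r → inj₁ (a , r)) (T-irrelevant q p)
  fg′ (inj₂ tt) with zero-or-nz A (0# A)
  ... | inj₁ _ = refl
  ... | inj₂ p = ⊥-elim (¬nz-0# A p)
  gf : ∀ a c → g (f a c) ≡ a
  gf a (inj₁ p) = sym p
  gf a (inj₂ _) = refl
  w : ∀ a c → wt (A ⁺ ⊎ʷ 𝟙ʷ) (f a c) ≡ wt (typ A) a
  w a (inj₁ refl) = sym (wt-0# A)
  w a (inj₂ _) = refl

-- `AB - 1 = (B - 1) + (A - 1) B`, according to whether the content of `A` is zero.
⊗⁺-split : ∀ A B → (A ⊗ B) ⁺ ≅ B ⁺ ⊎ʷ (A ⁺ ×ʷ typ B)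
⊗⁺-split A B = record
  { to = λ ((a , b) , p) → f a b (zero-or-nz A a) (T-∨⁻ p) ; from = g ; to-from = fg′
  ; from-to = λ ((a , b) , p) → Σ-≡ T-irrelevant (gf a b (zero-or-nz A a) (T-∨⁻ p))
  ; wt-to = λ ((a , b) , p) → w a b (zero-or-nz A a) (T-∨⁻ p) }
  where
  E = B ⁺ ⊎ʷ (A ⁺ ×ʷ typ B)
  f : ∀ a b → (a ≡ 0# A) ⊎ T (nz A a) → T (nz A a) ⊎ T (nz B b) → Car E
  f a b (inj₂ p) _ = inj₂ ((a , p) , b)
  f a b (inj₁ e) (inj₁ p) = ⊥-elim (¬nz-0# A (subst (T ∘ nz A) e p))
  f a b (inj₁ _) (inj₂ p) = inj₁ (b , p)
  g : Car E → Car ((A ⊗ B) ⁺)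
  g (inj₁ (b , p)) = (0# A , b) , T-∨⁺ (inj₂ p)
  g (inj₂ ((a , p) , b)) = (a , b) , T-∨⁺ (inj₁ p)
  fg′ : ∀ e → (let ((a , b) , p) = g e in f a b (zero-or-nz A a) (T-∨⁻ p)) ≡ e
  fg′ (inj₁ (b , p)) with zero-or-nz A (0# A) | T-∨⁻ {nz A (0# A)} {nz B b} (T-∨⁺ (inj₂ p))
  ... | inj₂ q | _ = ⊥-elim (¬nz-0# A q)
  ... | inj₁ _ | inj₁ q = ⊥-elim (¬nz-0# A q)
  ... | inj₁ _ | inj₂ q = cong (λ r → inj₁ (b , r)) (T-irrelevant q p)
  fg′ (inj₂ ((a , p) , b)) with zero-or-nz A a
  ... | inj₁ refl = ⊥-elim (¬nz-0# A p)
  ... | inj₂ q = cong (λ r → inj₂ ((a , r) , b)) (T-irrelevant q p)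
  gf : ∀ a b c d → proj₁ (g (f a b c d)) ≡ (a , b)
  gf a b (inj₂ _) _ = refl
  gf a b (inj₁ e) (inj₁ p) = ⊥-elim (¬nz-0# A (subst (T ∘ nz A) e p))
  gf a b (inj₁ e) (inj₂ _) = cong (_, b) (sym e)
  w : ∀ a b c d → wt E (f a b c d) ≡ wt (typ A) a ⊕ wt (typ B) b
  w a b (inj₂ _) _ = refl
  w a b (inj₁ e) (inj₁ p) = ⊥-elim (¬nz-0# A (subst (T ∘ nz A) e p))
  w a b (inj₁ refl) (inj₂ _) = cong (_⊕ wt (typ B) b) (sym (wt-0# A))

-- With `a = A - 1` and `b = B - 1` this is `AB - 1 = b + ab + a`.
⊗⁺-split₃ : ∀ A B → (A ⊗ B) ⁺ ≅ B ⁺ ⊎ʷ (A ⁺ ×ʷ B ⁺ ⊎ʷ A ⁺)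
⊗⁺-split₃ A B = ≅-trans (⊗⁺-split A B) (⊎ʷ-cong ≅-refl
  (≅-trans (×ʷ-cong ≅-refl (typ-split B)) (≅-trans ×ʷ-distribˡ (⊎ʷ-cong ≅-refl ×ʷ-identityʳ))))

-- Row-Fishburn matrices

-- A row of j cells of type A followed by a cell of type B.
Row : Cell → ℕ → Cell → Cell
Row A zero    B = B
Row A (suc j) B = Row A j (A ⊗ B)

Row-cong : ∀ A j {B C} → B ≅ᶜ C → Row A j B ≅ᶜ Row A j C
Row-cong A zero    e = e
Row-cong A (suc j) e = Row-cong A j (⊗-cong ≅ᶜ-refl e)

-- Neither the weight of a row nor its being nonzero depends on the order of its cells, so one can
-- be moved out to the front.
Row-⊗ : ∀ A j B C → Row A j (B ⊗ C) ≅ᶜ B ⊗ Row A j C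
Row-⊗ A zero    B C = ≅ᶜ-refl
Row-⊗ A (suc j) B C = ≅ᶜ-trans (Row-cong A j (⊗-swap {A} {B} {C})) (Row-⊗ A j B (A ⊗ C))

module Fishburn (X D : Cell) where

  -- j × j upper triangular matrices without zero rows, with last column in U.
  Rows : ℕ → Cell → Weighted
  Rows zero    U = 𝟙ʷ
  Rows (suc j) U = (Row X j U) ⁺ ×ʷ Rows j U

  -- (j+1) × (j+1) such matrices, with corner in Z and the rest of the first row in D.
  RowF : ℕ → Cell → Cell → Weighted
  RowF j U Z = (Row D j Z) ⁺ ×ʷ Rows j U

  -- This is `B(U)`, and `AllRowF U Z` is `R(U,Z)`. In both, index j stands for size j + 1, which
  -- leaves out the empty matrix.
  AllRows : Cell → Weighted
  AllRows U = Σʷ λ j → Rows (suc j) U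

  AllRowF : Cell → Cell → Weighted
  AllRowF U Z = Σʷ λ j → RowF j U Z

  AllF : Cell → Cell → Weighted
  AllF U Z = AllRowF U Z ⊎ʷ AllRows U

  -- By definition `Row X j (X ⊗ U)` is `Row X (suc j) U`: widening the last column lengthens every
  -- row by one cell. What is then missing from a matrix of size j + 1 is the bottom row with its
  -- single nonzero cell, supplied by u.
  Rows-suc : ∀ j U → U ⁺ ×ʷ Rows j (X ⊗ U) ≅ Rows (suc j) U
  Rows-suc zero    U = ≅-refl
  Rows-suc (suc j) U = ≅-trans ×ʷ-swap (×ʷ-cong ≅-refl (Rows-suc j U))

  -- The enlarged corner gives a first row with one more D and an extra factor U. If r counts the
  -- nonzero rows of D-cells ending in Z, then `⊗⁺-split₃` leaves r + ur + u for this row, and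
  -- `Rows-suc` spends the outer u on the rows below.
  RowF-suc : ∀ j U Z → U ⁺ ×ʷ RowF j (X ⊗ U) (D ⊗ (U ⊗ Z))
    ≅ RowF (suc j) U Z ⊎ʷ (U ⁺ ×ʷ RowF (suc j) U Z ⊎ʷ U ⁺ ×ʷ Rows (suc j) U)
  RowF-suc j U Z = ≅-trans ×ʷ-swap (≅-trans
    (×ʷ-cong (≅-trans (⁺-cong (Row-⊗ D (suc j) U Z)) (⊗⁺-split₃ U (Row D (suc j) Z))) (Rows-suc j U))
    distribute)
    where
    distribute : ∀ {A B C} → (A ⊎ʷ (B ×ʷ A ⊎ʷ B)) ×ʷ C ≅ (A ×ʷ C) ⊎ʷ (B ×ʷ (A ×ʷ C) ⊎ʷ B ×ʷ C)
    distribute {A} {B} {C} = record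
      { to = λ { (inj₁ a , c) → inj₁ (a , c) ; (inj₂ (inj₁ (b , a)) , c) → inj₂ (inj₁ (b , a , c)) ; (inj₂ (inj₂ b) , c) → inj₂ (inj₂ (b , c)) }
      ; from = λ { (inj₁ (a , c)) → inj₁ a , c ; (inj₂ (inj₁ (b , a , c))) → inj₂ (inj₁ (b , a)) , c ; (inj₂ (inj₂ (b , c))) → inj₂ (inj₂ b) , c }
      ; to-from = λ { (inj₁ _) → refl ; (inj₂ (inj₁ _)) → refl ; (inj₂ (inj₂ _)) → refl }
      ; from-to = λ { (inj₁ _ , _) → refl ; (inj₂ (inj₁ _) , _) → refl ; (inj₂ (inj₂ _) , _) → refl }
      ; wt-to = λ { (inj₁ _ , _) → refl ; (inj₂ (inj₁ (b , a)) , c) → sym (⊕-assoc (wt B b) (wt A a) (wt C c)) ; (inj₂ (inj₂ _) , _) → refl } }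

  -- In `UZ - 1 = z + uz + u` with `z = Z - 1`, the summands are the terms of size 1 of R, uR and B.
  -- The terms of larger size of R and uR, and all of uB, come from `RowF-suc`; those of B come from
  -- `Rows-suc`.
  AllF-equation : ∀ U Z → (U ⊗ Z) ⁺ ⊎ʷ (U ⁺ ×ʷ AllF (X ⊗ U) (D ⊗ (U ⊗ Z)))
    ≅ AllF U Z ⊎ʷ (U ⁺ ×ʷ AllF U Z)
  AllF-equation U Z = ≅-trans (⊎ʷ-cong smallest larger) (≅-trans rearrange
    (⊎ʷ-cong (⊎ʷ-cong (≅-sym Σʷ-suc) (≅-sym Σʷ-suc))
      (≅-trans (⊎ʷ-cong (≅-trans (≅-sym Σʷ-suc) (≅-sym ×ʷ-distribˡ-Σʷ)) (≅-sym ×ʷ-distribˡ-Σʷ))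
        (≅-sym ×ʷ-distribˡ))))
    where
    smallest : (U ⊗ Z) ⁺ ≅ RowF 0 U Z ⊎ʷ (U ⁺ ×ʷ RowF 0 U Z ⊎ʷ Rows 1 U)
    smallest = ≅-trans (⊗⁺-split₃ U Z) (⊎ʷ-cong (≅-sym ×ʷ-identityʳ)
      (⊎ʷ-cong (×ʷ-cong ≅-refl (≅-sym ×ʷ-identityʳ)) (≅-sym ×ʷ-identityʳ)))
    larger : U ⁺ ×ʷ AllF (X ⊗ U) (D ⊗ (U ⊗ Z)) ≅
      (Σʷ (λ j → RowF (suc j) U Z)
        ⊎ʷ (Σʷ (λ j → U ⁺ ×ʷ RowF (suc j) U Z) ⊎ʷ Σʷ (λ j → U ⁺ ×ʷ Rows (suc j) U)))
      ⊎ʷ Σʷ (λ j → Rows (suc (suc j)) U)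
    larger = ≅-trans ×ʷ-distribˡ (⊎ʷ-cong
      (≅-trans ×ʷ-distribˡ-Σʷ (≅-trans (Σʷ-cong λ j → RowF-suc j U Z)
        (≅-trans Σʷ-⊎ʷ (⊎ʷ-cong ≅-refl Σʷ-⊎ʷ))))
      (≅-trans ×ʷ-distribˡ-Σʷ (Σʷ-cong λ j → Rows-suc (suc j) U)))
    rearrange : ∀ {R₀ UR₀ P₀ R UR UP P} →
      (R₀ ⊎ʷ (UR₀ ⊎ʷ P₀)) ⊎ʷ ((R ⊎ʷ (UR ⊎ʷ UP)) ⊎ʷ P)
      ≅ ((R₀ ⊎ʷ R) ⊎ʷ (P₀ ⊎ʷ P)) ⊎ʷ ((UR₀ ⊎ʷ UR) ⊎ʷ UP)
    rearrange = record
      { to = λ { (inj₁ (inj₁ x)) → inj₁ (inj₁ (inj₁ x)) ; (inj₁ (inj₂ (inj₁ x))) → inj₂ (inj₁ (inj₁ x))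
               ; (inj₁ (inj₂ (inj₂ x))) → inj₁ (inj₂ (inj₁ x)) ; (inj₂ (inj₁ (inj₁ x))) → inj₁ (inj₁ (inj₂ x))
               ; (inj₂ (inj₁ (inj₂ (inj₁ x)))) → inj₂ (inj₁ (inj₂ x)) ; (inj₂ (inj₁ (inj₂ (inj₂ x)))) → inj₂ (inj₂ x)
               ; (inj₂ (inj₂ x)) → inj₁ (inj₂ (inj₂ x)) }
      ; from = λ { (inj₁ (inj₁ (inj₁ x))) → inj₁ (inj₁ x) ; (inj₂ (inj₁ (inj₁ x))) → inj₁ (inj₂ (inj₁ x))
                 ; (inj₁ (inj₂ (inj₁ x))) → inj₁ (inj₂ (inj₂ x)) ; (inj₁ (inj₁ (inj₂ x))) → inj₂ (inj₁ (inj₁ x))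
                 ; (inj₂ (inj₁ (inj₂ x))) → inj₂ (inj₁ (inj₂ (inj₁ x))) ; (inj₂ (inj₂ x)) → inj₂ (inj₁ (inj₂ (inj₂ x)))
                 ; (inj₁ (inj₂ (inj₂ x))) → inj₂ (inj₂ x) }
      ; to-from = λ { (inj₁ (inj₁ (inj₁ x))) → refl ; (inj₂ (inj₁ (inj₁ x))) → refl
                 ; (inj₁ (inj₂ (inj₁ x))) → refl ; (inj₁ (inj₁ (inj₂ x))) → refl
                 ; (inj₂ (inj₁ (inj₂ x))) → refl ; (inj₂ (inj₂ x)) → refl
                 ; (inj₁ (inj₂ (inj₂ x))) → refl }
      ; from-to = λ { (inj₁ (inj₁ x)) → refl ; (inj₁ (inj₂ (inj₁ x))) → refl
               ; (inj₁ (inj₂ (inj₂ x))) → refl ; (inj₂ (inj₁ (inj₁ x))) → refl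
               ; (inj₂ (inj₁ (inj₂ (inj₁ x)))) → refl ; (inj₂ (inj₁ (inj₂ (inj₂ x)))) → refl
               ; (inj₂ (inj₂ x)) → refl }
      ; wt-to = λ { (inj₁ (inj₁ x)) → refl ; (inj₁ (inj₂ (inj₁ x))) → refl
               ; (inj₁ (inj₂ (inj₂ x))) → refl ; (inj₂ (inj₁ (inj₁ x))) → refl
               ; (inj₂ (inj₁ (inj₂ (inj₁ x)))) → refl ; (inj₂ (inj₁ (inj₂ (inj₂ x)))) → refl
               ; (inj₂ (inj₂ x)) → refl } }

  Rows-fg : ∀ j U → FinitelyGraded (Rows j U)
  Rows-fg zero    U = 𝟙ʷ-fg
  Rows-fg (suc j) U = ×ʷ-fg (subʷ-fg (nz R) (fg R)) (Rows-fg j U)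
    where R = Row X j U

  -- Each of the j rows is nonzero and so has degree at least 1. This is the bound that `Σʷ-fg` asks
  -- for.
  Rows-deg : ∀ j U a → j ≤ deg (wt (Rows j U) a)
  Rows-deg zero    U _ = z≤n
  Rows-deg (suc j) U ((r , p) , a) = +-mono-≤ (deg-nz (Row X j U) r p) (Rows-deg j U a)

  AllF-fg : ∀ U Z → FinitelyGraded (AllF U Z)
  AllF-fg U Z = ⊎ʷ-fg
    (Σʷ-fg (λ j (r , a) → ≤-trans (Rows-deg j U a) (m≤n+m _ _))
      (λ j → ×ʷ-fg (subʷ-fg (nz (Row D j Z)) (fg (Row D j Z))) (Rows-fg j U)))
    (Σʷ-fg (λ j a → ≤-trans (m≤n+m j 1) (Rows-deg (suc j) U a)) (λ j → Rows-fg (suc j) U))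

-- Self-dual Fishburn matrices

-- Vectors stored from the outside in: the first and the last entry, then the inner ones.
Col : Set → ℕ → Set
Col A zero          = ⊤
Col A (suc zero)    = A
Col A (suc (suc k)) = A × A × Col A k

mapC : ∀ {A B : Set} k → (A → B) → Col A k → Col B k
mapC zero          f _            = tt
mapC (suc zero)    f a            = f a
mapC (suc (suc k)) f (a , b , as) = f a , f b , mapC k f as

zipC : ∀ {A B C : Set} k → (A → B → C) → Col A k → Col B k → Col C k
zipC zero          f _            _            = tt
zipC (suc zero)    f a            b            = f a b
zipC (suc (suc k)) f (a , b , as) (c , d , cs) = f a c , f b d , zipC k f as cs

anyC : ∀ {A : Set} k → (A → Bool) → Col A k → Bool
anyC zero          P _            = false
anyC (suc zero)    P a            = P a
anyC (suc (suc k)) P (a , b , as) = P a ∨ P b ∨ anyC k P as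

sumC : ∀ {A : Set} k → (A → Wt) → Col A k → Wt
sumC zero          w _            = 𝟘
sumC (suc zero)    w a            = w a
sumC (suc (suc k)) w (a , b , as) = w a ⊕ (w b ⊕ sumC k w as)

mapC-∘ : ∀ {A B C : Set} k (g : B → C) (f : A → B) as → mapC k g (mapC k f as) ≡ mapC k (g ∘ f) as
mapC-∘ zero          g f _            = refl
mapC-∘ (suc zero)    g f _            = refl
mapC-∘ (suc (suc k)) g f (a , b , as) = cong (λ cs → _ , _ , cs) (mapC-∘ k g f as)

mapC-cong : ∀ {A B : Set} k {f g : A → B} → (∀ a → f a ≡ g a) → ∀ as → mapC k f as ≡ mapC k g as
mapC-cong zero          e _            = refl
mapC-cong (suc zero)    e a            = e a
mapC-cong (suc (suc k)) e (a , b , as) = cong₂ _,_ (e a) (cong₂ _,_ (e b) (mapC-cong k e as))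

mapC-id : ∀ {A : Set} k (as : Col A k) → mapC k id as ≡ as
mapC-id zero          _            = refl
mapC-id (suc zero)    _            = refl
mapC-id (suc (suc k)) (a , b , as) = cong (λ cs → _ , _ , cs) (mapC-id k as)

mapC-id-where : ∀ {A : Set} k (f : A → A) (P : A → Bool) → (∀ a → P a ≡ false → f a ≡ a) →
  ∀ as → anyC k P as ≡ false → mapC k f as ≡ as
mapC-id-where zero          f P e _            _ = refl
mapC-id-where (suc zero)    f P e a            p = e a p
mapC-id-where (suc (suc k)) f P e (a , b , as) p with q , r ← ∨-false p with s , t ← ∨-false r =
  cong₂ _,_ (e a q) (cong₂ _,_ (e b s) (mapC-id-where k f P e as t))

mapC-zipC : ∀ {A B C D : Set} k (f : C → D) (g : A → B → C) as bs →
  mapC k f (zipC k g as bs) ≡ zipC k (λ a b → f (g a b)) as bs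
mapC-zipC zero          f g _ _ = refl
mapC-zipC (suc zero)    f g _ _ = refl
mapC-zipC (suc (suc k)) f g (_ , _ , as) (_ , _ , bs) = cong (λ cs → _ , _ , cs) (mapC-zipC k f g as bs)

zipC-mapC : ∀ {A B C D E : Set} k (f : C → D → E) (g : A → C) (h : B → D) as bs →
  zipC k f (mapC k g as) (mapC k h bs) ≡ zipC k (λ a b → f (g a) (h b)) as bs
zipC-mapC zero          f g h _ _ = refl
zipC-mapC (suc zero)    f g h _ _ = refl
zipC-mapC (suc (suc k)) f g h (_ , _ , as) (_ , _ , bs) = cong (λ cs → _ , _ , cs) (zipC-mapC k f g h as bs)

zipC-proj₁ : ∀ {A B : Set} k (as : Col A k) (bs : Col B k) → zipC k (λ a _ → a) as bs ≡ as
zipC-proj₁ zero          _ _ = refl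
zipC-proj₁ (suc zero)    _ _ = refl
zipC-proj₁ (suc (suc k)) (_ , _ , as) (_ , _ , bs) = cong (λ cs → _ , _ , cs) (zipC-proj₁ k as bs)

zipC-proj₂ : ∀ {A B : Set} k (as : Col A k) (bs : Col B k) → zipC k (λ _ b → b) as bs ≡ bs
zipC-proj₂ zero          _ _ = refl
zipC-proj₂ (suc zero)    _ _ = refl
zipC-proj₂ (suc (suc k)) (_ , _ , as) (_ , _ , bs) = cong (λ cs → _ , _ , cs) (zipC-proj₂ k as bs)

zipC-diag : ∀ {A B C D : Set} k (f : B → C → D) (g : A → B) (h : A → C) as →
  zipC k f (mapC k g as) (mapC k h as) ≡ mapC k (λ a → f (g a) (h a)) as
zipC-diag zero          f g h _ = refl
zipC-diag (suc zero)    f g h _ = refl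
zipC-diag (suc (suc k)) f g h (_ , _ , as) = cong (λ cs → _ , _ , cs) (zipC-diag k f g h as)

anyC-mapC : ∀ {A B : Set} k (P : B → Bool) (f : A → B) as → anyC k P (mapC k f as) ≡ anyC k (P ∘ f) as
anyC-mapC zero          P f _            = refl
anyC-mapC (suc zero)    P f _            = refl
anyC-mapC (suc (suc k)) P f (a , b , as) = cong (λ c → P (f a) ∨ P (f b) ∨ c) (anyC-mapC k P f as)

anyC-proj₁ : ∀ {A B : Set} k (P : A → Bool) as (bs : Col B k) →
  anyC k (P ∘ proj₁) (zipC k _,_ as bs) ≡ anyC k P as
anyC-proj₁ k P as bs = trans (sym (anyC-mapC k P proj₁ _))
  (cong (anyC k P) (trans (mapC-zipC k proj₁ _,_ as bs) (zipC-proj₁ k as bs)))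

anyC-false : ∀ {A : Set} k (P : A → Bool) → (∀ a → P a ≡ false) → ∀ as → anyC k P as ≡ false
anyC-false zero          P e _            = refl
anyC-false (suc zero)    P e a            = e a
anyC-false (suc (suc k)) P e (a , b , as) = cong₂ _∨_ (e a) (cong₂ _∨_ (e b) (anyC-false k P e as))

⊕-interchange : ∀ a b c d → (a ⊕ b) ⊕ (c ⊕ d) ≡ (a ⊕ c) ⊕ (b ⊕ d)
⊕-interchange = solve 4 (λ a b c d → ((a ⊙ b) ⊙ (c ⊙ d)) ⊜ ((a ⊙ c) ⊙ (b ⊙ d))) refl
  where open ⊕-Solver renaming (_⊕_ to _⊙_)

sumC-zipC : ∀ {A B : Set} k (v : A → Wt) (w : B → Wt) as bs →
  sumC k (λ (a , b) → v a ⊕ w b) (zipC k _,_ as bs) ≡ sumC k v as ⊕ sumC k w bs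
sumC-zipC zero          v w _ _ = refl
sumC-zipC (suc zero)    v w _ _ = refl
sumC-zipC (suc (suc k)) v w (a , b , as) (c , d , bs) = trans
  (cong (λ s → (v a ⊕ w c) ⊕ ((v b ⊕ w d) ⊕ s)) (sumC-zipC k v w as bs))
  (trans (cong ((v a ⊕ w c) ⊕_) (⊕-interchange (v b) (w d) _ _)) (⊕-interchange (v a) (w c) _ _))

sumC-mapC : ∀ {A B : Set} k (w : B → Wt) (f : A → B) as → sumC k w (mapC k f as) ≡ sumC k (w ∘ f) as
sumC-mapC zero          w f _            = refl
sumC-mapC (suc zero)    w f _            = refl
sumC-mapC (suc (suc k)) w f (a , b , as) = cong (λ c → w (f a) ⊕ (w (f b) ⊕ c)) (sumC-mapC k w f as)

T-contra : ∀ {b} → T b → ¬ T (not b)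
T-contra {true} _ ()

subʷ-split : ∀ A P → A ≅ subʷ A P ⊎ʷ subʷ A (not ∘ P)
subʷ-split A P = record { to = λ a → f a (T⊎T-not (P a)) ; from = g ; to-from = fg′
  ; from-to = λ a → gf a (T⊎T-not (P a)) ; wt-to = λ a → w a (T⊎T-not (P a)) }
  where
  T⊎T-not : ∀ b → T b ⊎ T (not b)
  T⊎T-not true  = inj₁ tt
  T⊎T-not false = inj₂ tt
  f : ∀ a → T (P a) ⊎ T (not (P a)) → Car (subʷ A P ⊎ʷ subʷ A (not ∘ P))
  f a (inj₁ p) = inj₁ (a , p)
  f a (inj₂ p) = inj₂ (a , p)
  g : Car (subʷ A P ⊎ʷ subʷ A (not ∘ P)) → Car A
  g (inj₁ (a , _)) = a
  g (inj₂ (a , _)) = a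
  fg′ : ∀ b → f (g b) (T⊎T-not (P (g b))) ≡ b
  fg′ (inj₁ (a , p)) with T⊎T-not (P a)
  ... | inj₁ q = cong (λ r → inj₁ (a , r)) (T-irrelevant q p)
  ... | inj₂ q = ⊥-elim (T-contra p q)
  fg′ (inj₂ (a , p)) with T⊎T-not (P a)
  ... | inj₁ q = ⊥-elim (T-contra q p)
  ... | inj₂ q = cong (λ r → inj₂ (a , r)) (T-irrelevant q p)
  gf : ∀ a c → g (f a c) ≡ a
  gf a (inj₁ _) = refl
  gf a (inj₂ _) = refl
  w : ∀ a c → wt (subʷ A P ⊎ʷ subʷ A (not ∘ P)) (f a c) ≡ wt A a
  w a (inj₁ _) = refl
  w a (inj₂ _) = refl

T-not⇒false : ∀ {b} → T (not b) → b ≡ false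
T-not⇒false {false} _ = refl

false⇒T-not : ∀ {b} → b ≡ false → T (not b)
false⇒T-not refl = tt

-- A self-dual matrix is determined by its diagonal and SE-cells. For size k + 2 these are the
-- corner, the cell (k+2, k+2), the rest of the last column, and the same data for the
-- central k × k submatrix.
Tri : Set → Set → ℕ → Set → Set → Set
Tri X D zero          U Z = ⊤
Tri X D (suc zero)    U Z = Z
Tri X D (suc (suc k)) U Z = Z × U × Col U k × Tri X D k X D

module SelfDual (X D : Cell) where
  open Fishburn X D

  triʷ : ℕ → Cell → Cell → Weighted
  Car (triʷ k U Z) = Tri (El X) (El D) k (El U) (El Z)
  wt (triʷ zero          U Z) _ = 𝟘
  wt (triʷ (suc zero)    U Z) z = wt (typ Z) z
  wt (triʷ (suc (suc k)) U Z) (z , u , us , c) =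
    wt (typ Z) z ⊕ (wt (typ U) u ⊕ (sumC k (wt (typ U)) us ⊕ wt (triʷ k X D) c))

  -- Every column of the central submatrix c is nonzero once it is extended by the cells in
  -- the first row of the full matrix; es records which of these are nonzero, indexed by the
  -- dual cells in the last column.
  goodCore : ∀ k → Car (triʷ k X D) → Col Bool k → Bool
  goodCore zero          _ _ = true
  goodCore (suc zero)    d e = nz D d ∨ e
  goodCore (suc (suc k)) (d , x , xs , c) (e , e′ , es) =
    (nz X x ∨ e′) ∧ ((nz D d ∨ e) ∨ (nz X x ∨ anyC k (nz X) xs))
      ∧ goodCore k c (zipC k _∨_ (mapC k (nz X) xs) es)

  -- Only columns are tested, since duality carries the condition over to rows. From size 2 on, the
  -- first column has the single cell (1,1), dual to the bottom cell `u` of the last column; so a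
  -- nonzero `u` settles both outer columns. The cells above the core are dual to `us`.
  good : ∀ k U Z → Car (triʷ k U Z) → Bool
  good zero          U Z _ = true
  good (suc zero)    U Z z = nz Z z
  good (suc (suc k)) U Z (z , u , us , c) = nz U u ∧ goodCore k c (mapC k (nz U) us)

  SD : ℕ → Cell → Cell → Weighted
  SD k U Z = subʷ (triʷ k U Z) (good k U Z)

  AllSD : Cell → Cell → Weighted
  AllSD U Z = Σʷ λ k → SD (suc k) U Z

  -- Merging the first two rows and the last two columns

  module _ (U Z : Cell) where

    UX = X ⊗ U
    DUZ = D ⊗ (U ⊗ Z)

    -- With n = k + 3, the content `u` of the dual cells (1,1) and (n,n) is split off along with the
    -- first column and the last row, so the size drops by two. The new corner collects the cells
    -- (1,n), (2,n), (1,n-1) and (2,n-1), of which the middle two are dual and stored once as `u₁`.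
    -- Every other cell of the new last column joins an X of the core to a U.
    merge : ∀ k → Car (triʷ (3 + k) U Z) → El U × Car (triʷ (1 + k) UX DUZ)
    merge zero    (z , u , u₁ , d) = u , (d , u₁ , z)
    merge (suc k) (z , u , (u₁ , u₂ , us) , (d , x , xs , c)) = u , (d , u₁ , z) , (x , u₂) , zipC k _,_ xs us , c

    unmerge : ∀ k → El U × Car (triʷ (1 + k) UX DUZ) → Car (triʷ (3 + k) U Z)
    unmerge zero    (u , (d , u₁ , z)) = z , u , u₁ , d
    unmerge (suc k) (u , (d , u₁ , z) , (x , u₂) , xus , c) =
      z , u , (u₁ , u₂ , mapC k proj₂ xus) , (d , x , mapC k proj₁ xus , c)

    merge-unmerge : ∀ k t → merge k (unmerge k t) ≡ t
    merge-unmerge zero    _ = refl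
    merge-unmerge (suc k) (_ , _ , _ , xus , _) =
      cong (λ v → _ , _ , _ , v , _) (trans (zipC-diag k _,_ proj₁ proj₂ xus) (mapC-id k xus))

    unmerge-merge : ∀ k t → unmerge k (merge k t) ≡ t
    unmerge-merge zero    _ = refl
    unmerge-merge (suc k) (_ , _ , (_ , _ , us) , (_ , _ , xs , _)) = cong₂ (λ v w → _ , _ , (_ , _ , v) , (_ , _ , w , _))
      (trans (mapC-zipC k proj₂ _,_ xs us) (zipC-proj₂ k xs us))
      (trans (mapC-zipC k proj₁ _,_ xs us) (zipC-proj₁ k xs us))

    wt-merge : ∀ k t → wt (typ U ×ʷ triʷ (1 + k) UX DUZ) (merge k t) ≡ wt (triʷ (3 + k) U Z) t
    wt-merge zero (z , u , u₁ , d) = solve 4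
      (λ z u u₁ d → (u ⊙ (d ⊙ (u₁ ⊙ z))) ⊜ (z ⊙ (u ⊙ (u₁ ⊙ d)))) refl
      (wt (typ Z) z) (wt (typ U) u) (wt (typ U) u₁) (wt (typ D) d)
      where open ⊕-Solver renaming (_⊕_ to _⊙_)
    wt-merge (suc k) (z , u , (u₁ , u₂ , us) , (d , x , xs , c)) = trans
      (cong (λ s → wt (typ U) u ⊕ ((wt (typ D) d ⊕ (wt (typ U) u₁ ⊕ wt (typ Z) z)) ⊕ ((wt (typ X) x ⊕ wt (typ U) u₂) ⊕ (s ⊕ wt (triʷ k X D) c))))
        (sumC-zipC k (wt (typ X)) (wt (typ U)) xs us))
      (solve 9 (λ z u u₁ u₂ us d x xs c →
          (u ⊙ ((d ⊙ (u₁ ⊙ z)) ⊙ ((x ⊙ u₂) ⊙ ((xs ⊙ us) ⊙ c))))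
          ⊜ (z ⊙ (u ⊙ ((u₁ ⊙ (u₂ ⊙ us)) ⊙ (d ⊙ (x ⊙ (xs ⊙ c))))))) refl
        (wt (typ Z) z) (wt (typ U) u) (wt (typ U) u₁) (wt (typ U) u₂) (sumC k (wt (typ U)) us)
        (wt (typ D) d) (wt (typ X) x) (sumC k (wt (typ X)) xs) (wt (triʷ k X D) c))
      where open ⊕-Solver renaming (_⊕_ to _⊙_)

    -- The last but one column of the unmerged matrix is nonzero.
    hook : ∀ k → Car (triʷ (1 + k) UX DUZ) → Bool
    hook zero    (d , u₁ , _) = nz D d ∨ nz U u₁
    hook (suc k) ((d , u₁ , _) , (x , _) , xus , _) = (nz D d ∨ nz U u₁) ∨ (nz X x ∨ anyC k (nz X ∘ proj₁) xus)

    goodCore-merge : ∀ k c xs us →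
      goodCore k c (zipC k _∨_ (mapC k (nz X) xs) (mapC k (nz U) us))
      ≡ goodCore k c (mapC k (nz UX) (zipC k _,_ xs us))
    goodCore-merge k c xs us = cong (goodCore k c)
      (trans (zipC-mapC k _∨_ (nz X) (nz U) xs us) (sym (mapC-zipC k (nz UX) _,_ xs us)))

    -- The tests before and after the merge agree conjunct by conjunct, except that the one on the
    -- last but one column is lost; `hook` restores it. If k = 0, the merged matrix is a single cell
    -- and its test follows from `hook`.
    good-merge : ∀ k t → T (good (3 + k) U Z t) →
      T (nz U (proj₁ (merge k t))) × T (good (1 + k) UX DUZ (proj₂ (merge k t))) × T (hook k (proj₂ (merge k t)))
    good-merge zero (z , u , u₁ , d) p with T-∧⁻ p
    ... | q , r with T-∨⁻ {nz D d} r
    ...   | inj₁ s = q , T-∨⁺ (inj₁ s) , r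
    ...   | inj₂ s = q , T-∨⁺ {nz D d} (inj₂ (T-∨⁺ (inj₁ s))) , r
    good-merge (suc k) (z , u , (u₁ , u₂ , us) , (d , x , xs , c)) p
      with q , r ← T-∧⁻ p with s , r ← T-∧⁻ {nz X x ∨ nz U u₂} r with h , g ← T-∧⁻ {(nz D d ∨ nz U u₁) ∨ (nz X x ∨ anyC k (nz X) xs)} r =
      q , T-∧⁺ {nz X x ∨ nz U u₂} s (subst T (goodCore-merge k c xs us) g)
        , subst (λ a → T ((nz D d ∨ nz U u₁) ∨ (nz X x ∨ a))) (sym (anyC-proj₁ k (nz X) xs us)) h

    good-merge⁻ : ∀ k t → T (nz U (proj₁ (merge k t))) → T (good (1 + k) UX DUZ (proj₂ (merge k t))) →
      T (hook k (proj₂ (merge k t))) → T (good (3 + k) U Z t)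
    good-merge⁻ zero    _ p _ q = T-∧⁺ p q
    good-merge⁻ (suc k) (z , u , (u₁ , u₂ , us) , (d , x , xs , c)) p q h with s , g ← T-∧⁻ {nz X x ∨ nz U u₂} q =
      T-∧⁺ p (T-∧⁺ {nz X x ∨ nz U u₂} s (T-∧⁺
        (subst (λ a → T ((nz D d ∨ nz U u₁) ∨ (nz X x ∨ a))) (anyC-proj₁ k (nz X) xs us) h)
        (subst T (sym (goodCore-merge k c xs us)) g)))

    SD-merge : ∀ k → SD (3 + k) U Z ≅ U ⁺ ×ʷ subʷ (SD (1 + k) UX DUZ) (hook k ∘ proj₁)
    SD-merge k = record
      { to = λ (t , p) → let u , t′ = merge k t ; q , g , h = good-merge k t p in (u , q) , (t′ , g) , h
      ; from = λ ((u , q) , (t , g) , h) → unmerge k (u , t) ,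
          good-merge⁻ k _ (subst (λ s → T (nz U (proj₁ s))) (sym (merge-unmerge k (u , t))) q)
            (subst (λ s → T (good (1 + k) UX DUZ (proj₂ s))) (sym (merge-unmerge k (u , t))) g)
            (subst (λ s → T (hook k (proj₂ s))) (sym (merge-unmerge k (u , t))) h)
      ; to-from = λ ((u , q) , (t , g) , h) → cong₂ _,_
          (Σ-≡ T-irrelevant (cong proj₁ (merge-unmerge k (u , t))))
          (Σ-≡ T-irrelevant (Σ-≡ T-irrelevant (cong proj₂ (merge-unmerge k (u , t)))))
      ; from-to = λ (t , p) → Σ-≡ T-irrelevant (unmerge-merge k t)
      ; wt-to = λ (t , p) → wt-merge k t }

    -- The merged matrices that do not unmerge to a Fishburn matrix.
    embed : ∀ k → Car (triʷ (1 + k) U Z) → Car (triʷ (1 + k) UX DUZ)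
    embed zero    z = 0# D , 0# U , z
    embed (suc k) (z , u , us , c) = (0# D , 0# U , z) , (0# X , u) , mapC k (0# X ,_) us , c

    unembed : ∀ k → Car (triʷ (1 + k) UX DUZ) → Car (triʷ (1 + k) U Z)
    unembed zero    (_ , _ , z) = z
    unembed (suc k) ((_ , _ , z) , (_ , u) , xus , c) = z , u , mapC k proj₂ xus , c

    unembed-embed : ∀ k t → unembed k (embed k t) ≡ t
    unembed-embed zero    _ = refl
    unembed-embed (suc k) (_ , _ , us , _) = cong (λ v → _ , _ , v , _)
      (trans (mapC-∘ k proj₂ (0# X ,_) us) (mapC-id k us))

    embed-unembed : ∀ k t → hook k t ≡ false → embed k (unembed k t) ≡ t
    embed-unembed zero (d , u₁ , z) p with q , r ← ∨-false p =
      cong₂ (λ a b → a , b , z) (sym (nz-false D d q)) (sym (nz-false U u₁ r))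
    embed-unembed (suc k) ((d , u₁ , z) , (x , u) , xus , c) p
      with p₁ , p₂ ← ∨-false p with q , r ← ∨-false {nz D d} p₁ with s , v ← ∨-false p₂ =
      cong₂ _,_ (cong₂ (λ a b → a , b , z) (sym (nz-false D d q)) (sym (nz-false U u₁ r)))
        (cong₂ _,_ (cong (_, u) (sym (nz-false X x s)))
          (cong (_, c) (trans (mapC-∘ k (0# X ,_) proj₂ xus)
            (mapC-id-where k _ (nz X ∘ proj₁) (λ (y , w) e → cong (_, w) (sym (nz-false X y e))) xus v))))

    hook-embed : ∀ k t → hook k (embed k t) ≡ false
    hook-embed zero    _ = cong₂ _∨_ (nz-0# D) (nz-0# U)
    hook-embed (suc k) (_ , _ , us , _) = cong₂ _∨_ (cong₂ _∨_ (nz-0# D) (nz-0# U)) (cong₂ _∨_ (nz-0# X)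
      (trans (anyC-mapC k (nz X ∘ proj₁) (0# X ,_) us) (anyC-false k _ (λ _ → nz-0# X) us)))

    good-embed : ∀ k t → good (1 + k) UX DUZ (embed k t) ≡ good (1 + k) U Z t
    good-embed zero    z = cong₂ _∨_ (nz-0# D) (cong (_∨ nz Z z) (nz-0# U))
    good-embed (suc k) (z , u , us , c) = cong₂ _∧_ (cong (_∨ nz U u) (nz-0# X))
      (cong (goodCore k c) (trans (mapC-∘ k (nz UX) (0# X ,_) us)
        (mapC-cong k (λ a → cong (_∨ nz U a) (nz-0# X)) us)))

    wt-embed : ∀ k t → wt (triʷ (1 + k) UX DUZ) (embed k t) ≡ wt (triʷ (1 + k) U Z) t
    wt-embed zero    z = cong₂ _⊕_ (wt-0# D) (cong (_⊕ wt (typ Z) z) (wt-0# U))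
    wt-embed (suc k) (z , u , us , c) = cong₂ _⊕_ (cong₂ _⊕_ (wt-0# D) (cong (_⊕ wt (typ Z) z) (wt-0# U)))
      (cong₂ _⊕_ (cong (_⊕ wt (typ U) u) (wt-0# X))
        (cong (_⊕ wt (triʷ k X D) c) (trans (sumC-mapC k (wt (typ UX)) (0# X ,_) us)
          (sumC-cong k (λ a → cong (_⊕ wt (typ U) a) (wt-0# X)) us))))
      where
      sumC-cong : ∀ {A : Set} k {v w : A → Wt} → (∀ a → v a ≡ w a) → ∀ as → sumC k v as ≡ sumC k w as
      sumC-cong zero          e _            = refl
      sumC-cong (suc zero)    e a            = e a
      sumC-cong (suc (suc k)) e (a , b , as) = cong₂ _⊕_ (e a) (cong₂ _⊕_ (e b) (sumC-cong k e as))

    -- A false `hook` says that every D and X taken from the last but one column, and `u₁` with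
    -- them, is zero. The U and Z left over form an arbitrary self-dual Fishburn matrix of the same
    -- size.
    SD-embed : ∀ k → subʷ (SD (1 + k) UX DUZ) (not ∘ hook k ∘ proj₁) ≅ SD (1 + k) U Z
    SD-embed k = ≅-sym (record
      { to = λ (t , g) → (embed k t , subst T (sym (good-embed k t)) g) , false⇒T-not (hook-embed k t)
      ; from = λ ((t , g) , h) → unembed k t ,
          subst T (trans (cong (good (1 + k) UX DUZ) (sym (embed-unembed k t (T-not⇒false h)))) (good-embed k (unembed k t))) g
      ; to-from = λ ((t , g) , h) → Σ-≡ T-irrelevant (Σ-≡ T-irrelevant (embed-unembed k t (T-not⇒false h)))
      ; from-to = λ (t , g) → Σ-≡ T-irrelevant (unembed-embed k t)
      ; wt-to = λ (t , g) → wt-embed k t })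

    -- The right-hand side is split by `hook`: a true one unmerges to size k + 3, a false one comes
    -- from a matrix of size k + 1.
    SD-recurrence : ∀ k → SD (3 + k) U Z ⊎ʷ (U ⁺ ×ʷ SD (1 + k) U Z) ≅ U ⁺ ×ʷ SD (1 + k) UX DUZ
    SD-recurrence k = ≅-sym (≅-trans (×ʷ-cong ≅-refl (subʷ-split (SD (1 + k) UX DUZ) (hook k ∘ proj₁)))
      (≅-trans ×ʷ-distribˡ (⊎ʷ-cong (≅-sym (SD-merge k)) (×ʷ-cong ≅-refl (SD-embed k)))))

    -- The sizes that no unmerging reaches: `(Z - 1) + uZ = UZ - 1`.
    SD-initial : SD 1 U Z ⊎ʷ SD 2 U Z ≅ (U ⊗ Z) ⁺
    SD-initial = ≅-trans (⊎ʷ-cong size₁ size₂) (≅-sym (⊗⁺-split U Z))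
      where
      size₁ : SD 1 U Z ≅ Z ⁺
      size₁ = record { to = id ; from = id ; to-from = λ _ → refl ; from-to = λ _ → refl ; wt-to = λ _ → refl }
      size₂ : SD 2 U Z ≅ U ⁺ ×ʷ typ Z
      size₂ = record
        { to = λ ((z , u , _) , p) → (u , proj₁ (T-∧⁻ p)) , z
        ; from = λ ((u , p) , z) → (z , u , tt , tt) , T-∧⁺ p tt
        ; to-from = λ ((u , p) , z) → cong (_, z) (Σ-≡ T-irrelevant refl)
        ; from-to = λ _ → Σ-≡ T-irrelevant refl
        ; wt-to = λ ((z , u , _) , p) → trans (⊕-comm (wt (typ U) u) _) (cong (wt (typ Z) z ⊕_) (sym (⊕-identityʳ _))) }

    AllSD-equation : AllSD U Z ⊎ʷ (U ⁺ ×ʷ AllSD U Z) ≅ (U ⊗ Z) ⁺ ⊎ʷ (U ⁺ ×ʷ AllSD UX DUZ)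
    AllSD-equation = ≅-trans
      (⊎ʷ-cong (≅-trans Σʷ-suc (≅-trans (⊎ʷ-cong ≅-refl Σʷ-suc) (≅-sym ⊎ʷ-assoc))) ×ʷ-distribˡ-Σʷ)
      (≅-trans ⊎ʷ-assoc (⊎ʷ-cong SD-initial
        (≅-trans (≅-sym Σʷ-⊎ʷ) (≅-trans (Σʷ-cong SD-recurrence) (≅-sym ×ʷ-distribˡ-Σʷ)))))

  -- Both sides satisfy the same equation F(U,Z) + u F(U,Z) = (UZ - 1) + u F(XU,DUZ), and the
  -- factor u makes this a recursion on the degree.
  AllSD↔AllF : ∀ U Z w → AllSD U Z [ w ] ↔ AllF U Z [ w ]
  AllSD↔AllF U Z w = <-rec Claim step (deg w) U Z w refl
    where
    Claim : ℕ → Set₁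
    Claim N = ∀ U Z w → deg w ≡ N → AllSD U Z [ w ] ↔ AllF U Z [ w ]

    step : ∀ N → (∀ {n} → n < N → Claim n) → Claim N
    -- By the induction hypothesis `u S(U,Z)` may be replaced by `u (R + B)(U,Z)`, so that the same
    -- finite set stands on both sides and can be cancelled.
    step N IH U Z w refl = fibre-cancel (×ʷ-fg (subʷ-fg (nz U) (fg U)) (AllF-fg U Z)) w
      (↔-trans (↔-refl ⊎-↔ ↔-sym (lower U Z))
      (↔-trans (↔-sym (fibre-⊎ (AllSD U Z) (U ⁺ ×ʷ AllSD U Z) w))
      (↔-trans (fibre-↔ (AllSD-equation U Z) w)
      (↔-trans (fibre-⊎ ((U ⊗ Z) ⁺) (U ⁺ ×ʷ AllSD (X ⊗ U) (D ⊗ (U ⊗ Z))) w)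
      (↔-trans (↔-refl ⊎-↔ lower (X ⊗ U) (D ⊗ (U ⊗ Z)))
      (↔-trans (↔-sym (fibre-⊎ ((U ⊗ Z) ⁺) (U ⁺ ×ʷ AllF (X ⊗ U) (D ⊗ (U ⊗ Z))) w))
      (↔-trans (fibre-↔ (AllF-equation U Z) w)
      (fibre-⊎ (AllF U Z) (U ⁺ ×ʷ AllF U Z) w))))))))
      where
      lower : ∀ U′ Z′ → (U ⁺ ×ʷ AllSD U′ Z′) [ w ] ↔ (U ⁺ ×ʷ AllF U′ Z′) [ w ]
      lower U′ Z′ = ↔-trans (fibre-× (U ⁺) (AllSD U′ Z′) w) (↔-trans
        (Σ-cong-↔ λ (u , p) → Σ-cong-↔ λ (v , e) →
          -- The factor u takes up at least one unit of the degree of `w`.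
          IH (subst (suc (deg v) ≤_) (cong deg e) (+-monoˡ-≤ (deg v) (deg-nz U u p))) U′ Z′ v refl)
        (↔-sym (fibre-× (U ⁺) (AllF U′ Z′) w)))

-- Finite conjunctions, disjunctions and sums

allF⁻ : ∀ {k} {f : Fin k → Bool} → T (allF f) → ∀ i → T (f i)
allF⁻ p fzero    = proj₁ (T-∧⁻ p)
allF⁻ {f = f} p (fsuc i) = allF⁻ (proj₂ (T-∧⁻ {f fzero} p)) i

allF⁺ : ∀ {k} {f : Fin k → Bool} → (∀ i → T (f i)) → T (allF f)
allF⁺ {zero}  p = tt
allF⁺ {suc k} p = T-∧⁺ (p fzero) (allF⁺ (p ∘ fsuc))

anyF⁻ : ∀ {k} {f : Fin k → Bool} → T (anyF f) → ∃ λ i → T (f i)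
anyF⁻ {suc k} {f} p with T-∨⁻ {f fzero} p
... | inj₁ q = fzero , q
... | inj₂ q with i , r ← anyF⁻ {k} q = fsuc i , r

anyF⁺ : ∀ {k} {f : Fin k → Bool} → (∃ λ i → T (f i)) → T (anyF f)
anyF⁺ (fzero , p) = T-∨⁺ (inj₁ p)
anyF⁺ {f = f} (fsuc i , p) = T-∨⁺ {f fzero} (inj₂ (anyF⁺ (i , p)))

sumF-cong : ∀ {k} {f g : Fin k → ℕ} → (∀ i → f i ≡ g i) → sumF f ≡ sumF g
sumF-cong {zero}  e = refl
sumF-cong {suc k} e = cong₂ _+_ (e fzero) (sumF-cong (e ∘ fsuc))

sumF-zero : ∀ {k} {f : Fin k → ℕ} → (∀ i → f i ≡ 0) → sumF f ≡ 0
sumF-zero {zero}  e = refl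
sumF-zero {suc k} e = cong₂ _+_ (e fzero) (sumF-zero (e ∘ fsuc))

term≤sumF : ∀ {k} (f : Fin k → ℕ) i → f i ≤ sumF f
term≤sumF f fzero    = m≤m+n _ _
term≤sumF f (fsuc i) = ≤-trans (term≤sumF (f ∘ fsuc) i) (m≤n+m _ (f fzero))

-- Matrices over the admissible cell values

ok : Bool → ℕ → Bool
ok true  v = v <ᵇ 2
ok false v = true

ok-0 : ∀ prim → T (ok prim 0)
ok-0 true  = tt
ok-0 false = tt

-- Primitivity is put into the type of the entries, so that the general and the primitive case are
-- instances of one construction.
record Val (prim : Bool) : Set where
  constructor mkVal
  field
    val    : ℕ
    val-ok : T (ok prim val)
open Val

0ᵥ : ∀ {prim} → Val prim
0ᵥ {prim} = mkVal 0 (ok-0 prim)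

Val-≡ : ∀ {prim} {x y : Val prim} → val x ≡ val y → x ≡ y
Val-≡ {x = mkVal v p} {mkVal _ q} refl = cong (mkVal v) (T-irrelevant p q)

-- The default 0 makes the map total; matrices that pass `primOK` never reach it.
clamp : ∀ {prim} → ℕ → Val prim
clamp {prim} v with T? (ok prim v)
... | yes p = mkVal v p
... | no _  = 0ᵥ

clamp-ok : ∀ {prim v} → T (ok prim v) → val (clamp {prim} v) ≡ v
clamp-ok {prim} {v} p with T? (ok prim v)
... | yes _ = refl
... | no ¬p = ⊥-elim (¬p p)

clamp-val : ∀ {prim} (x : Val prim) → clamp (val x) ≡ x
clamp-val {prim} (mkVal v p) = Val-≡ (clamp-ok {prim} p)

MatV : Bool → ℕ → Set
MatV prim k = Vec (Vec (Val prim) k) k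

entryV : ∀ {prim k} → MatV prim k → Fin k → Fin k → ℕ
entryV V i j = val (lookup (lookup V i) j)

erase : ∀ {prim k l} → Vec (Vec (Val prim) k) l → Vec (Vec ℕ k) l
erase = Vec.map (Vec.map val)

restore : ∀ {prim k l} → Vec (Vec ℕ k) l → Vec (Vec (Val prim) k) l
restore = Vec.map (Vec.map clamp)

entry-erase : ∀ {prim k} (V : MatV prim k) i j → entry (erase V) i j ≡ entryV V i j
entry-erase V i j = trans (cong (λ r → lookup r j) (lookup-map i (Vec.map val) V)) (lookup-map j val (lookup V i))

restore-erase : ∀ {prim k l} (V : Vec (Vec (Val prim) k) l) → restore (erase V) ≡ V
restore-erase V = trans (sym (map-∘ _ _ V)) (trans
  (map-cong (λ r → trans (sym (map-∘ _ _ r)) (trans (map-cong clamp-val r) (map-id r))) V) (map-id V))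

map-id-where : ∀ {A : Set} {k} {f : A → A} (v : Vec A k) → (∀ i → f (lookup v i) ≡ lookup v i) → Vec.map f v ≡ v
map-id-where []      e = refl
map-id-where (a ∷ v) e = cong₂ _∷_ (e fzero) (map-id-where v (e ∘ fsuc))

erase-restore : ∀ {prim k l} (M : Vec (Vec ℕ k) l) → (∀ i j → T (ok prim (lookup (lookup M i) j))) →
  erase (restore {prim} M) ≡ M
erase-restore {prim} M p = trans (sym (map-∘ _ _ M)) (map-id-where M λ i →
  trans (sym (map-∘ _ _ (lookup M i))) (map-id-where (lookup M i) λ j → clamp-ok {prim} (p i j)))

primOK⁻ : ∀ prim {k} (M : Mat k) → T (primOK prim M) → ∀ i j → T (ok prim (entry M i j))
primOK⁻ true  M p i j = allF⁻ (allF⁻ {f = λ i → allF λ j → entry M i j <ᵇ 2} p i) j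
primOK⁻ false M p i j = tt

primOK-erase : ∀ prim {k} (V : MatV prim k) → T (primOK prim (erase V))
primOK-erase true  V = allF⁺ λ i → allF⁺ λ j →
  subst (λ v → T (v <ᵇ 2)) (sym (entry-erase V i j)) (val-ok (lookup (lookup V i) j))
primOK-erase false V = tt

matʷ : Bool → (∀ {k} → Mat k → Bool) → (∀ {k} → Mat k → Wt) → ℕ → Weighted
Car (matʷ prim P st k) = Σ (MatV prim k) λ V → T (P (erase V))
wt (matʷ prim P st k) (V , _) = st (erase V)

-- A family ranges over all sizes, the weighted sums only over positive ones. The last hypothesis
-- excludes the empty matrix by its weight.
Family↔fibre : ∀ prim (F P : ∀ {k} → Mat k → Bool) (st : ∀ {k} → Mat k → Wt) w →
  (∀ {k} (M : Mat k) → T (F M) → T (P M) × st M ≡ w × T (primOK prim M)) →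
  (∀ {k} (M : Mat k) → T (P M) → st M ≡ w → T (primOK prim M) → T (F M)) →
  ¬ (st {0} [] ≡ w) → Family F ↔ Σʷ (λ k → matʷ prim P st (suc k)) [ w ]
Family↔fibre prim F P st w F⇒ ⇒F ¬empty = mk↔ₛ′ f g fg′ gf
  where
  Target = Σʷ (λ k → matʷ prim P st (suc k)) [ w ]
  eq : ∀ {k} (M : Mat k) → T (F M) → erase (restore {prim} M) ≡ M
  eq M p = erase-restore M (primOK⁻ prim M (proj₂ (proj₂ (F⇒ M p))))
  f : Family F → Target
  f (zero  , [] , p) = ⊥-elim (¬empty (proj₁ (proj₂ (F⇒ [] p))))
  f (suc k , M , p) = (k , restore M , subst (T ∘ P) (sym (eq M p)) (proj₁ (F⇒ M p))) ,
    trans (cong st (eq M p)) (proj₁ (proj₂ (F⇒ M p)))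
  g : Target → Family F
  g ((k , V , p) , q) = suc k , erase V , ⇒F (erase V) p q (primOK-erase prim V)
  fg′ : ∀ t → f (g t) ≡ t
  fg′ ((k , V , p) , q) = Σ-≡ ≡-irrelevant (cong (k ,_) (Σ-≡ T-irrelevant (restore-erase V)))
  gf : ∀ t → g (f t) ≡ t
  gf (zero  , [] , p) = ⊥-elim (¬empty (proj₁ (proj₂ (F⇒ [] p))))
  gf (suc k , M , p) = cong (suc k ,_) (Σ-≡ T-irrelevant (eq M p))

module _ (prim : Bool) (s : ℕ → Wt) (s-0 : s 0 ≡ 𝟘) (deg-s : ∀ v → deg (s v) ≡ v) where

  valʷ : Weighted
  Car valʷ = Val prim
  wt valʷ x = s (val x)

  valCell : Cell
  typ valCell = valʷ
  nz valCell x = nonzero (val x)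
  0# valCell = 0ᵥ
  nz-0# valCell = refl
  nz-false valCell (mkVal zero _) _ = Val-≡ refl
  wt-0# valCell = s-0
  deg-nz valCell (mkVal (suc v) _) _ = subst (1 ≤_) (sym (deg-s (suc v))) (s≤s z≤n)
  fg valCell = record
    { dec = λ x y → map′ Val-≡ (cong val) (val x ≟ val y)
    ; upto = λ N → map clamp (upTo (suc N))
    ; ∈-upto = λ N x x≤ → subst (_∈ map clamp (upTo (suc N))) (clamp-val x)
        (∈-map⁺ clamp (∈-upTo⁺ (s≤s (subst (_≤ N) (deg-s (val x)) x≤)))) }

-- Every entry counts towards the degree; in addition Y counts towards max, D towards dg or min, and
-- Q towards iso.
cellX cellY cellD cellQ : Bool → Cell
cellX prim = valCell prim (λ v → v , 0 , 0 , 0) refl (λ _ → refl)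
cellY prim = valCell prim (λ v → v , v , 0 , 0) refl (λ _ → refl)
cellD prim = valCell prim (λ v → v , 0 , v , 0) refl (λ _ → refl)
cellQ prim = valCell prim (λ v → v , 0 , 0 , v) refl (λ _ → refl)

-- Row-Fishburn matrices row by row

UpperTriangular RowsNonzero ColsNonzero : ∀ {k} → (Fin k → Fin k → ℕ) → Set
UpperTriangular e = ∀ i j → toℕ j < toℕ i → e i j ≡ 0
RowsNonzero e = ∀ i → ∃ λ j → T (nonzero (e i j))
ColsNonzero e = ∀ j → ∃ λ i → T (nonzero (e i j))

if-T : ∀ {b c} → T (if b then c else true) → T b → T c
if-T {true} p _ = p

T-if : ∀ {b c} → (T b → T c) → T (if b then c else true)
T-if {true}  p = p tt
T-if {false} p = tt

upperTriangular⁻ : ∀ {k} (M : Mat k) → T (upperTriangular M) → UpperTriangular (entry M)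
upperTriangular⁻ M p i j j<i = ≡ᵇ⇒≡ _ 0 (if-T {pos j <ᵇ pos i} (allF⁻ (allF⁻ p i) j) (<⇒<ᵇ (s≤s j<i)))

upperTriangular⁺ : ∀ {k} (M : Mat k) → UpperTriangular (entry M) → T (upperTriangular M)
upperTriangular⁺ M p = allF⁺ λ i → allF⁺ λ j → T-if {pos j <ᵇ pos i} λ q →
  ≡⇒≡ᵇ _ 0 (p i j (<ᵇ⇒< (toℕ j) (toℕ i) q))

everyRowNonzero⁻ : ∀ {k} (M : Mat k) → T (everyRowNonzero M) → RowsNonzero (entry M)
everyRowNonzero⁻ M p i = anyF⁻ (allF⁻ p i)

everyRowNonzero⁺ : ∀ {k} (M : Mat k) → RowsNonzero (entry M) → T (everyRowNonzero M)
everyRowNonzero⁺ M p = allF⁺ λ i → anyF⁺ (p i)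

everyColNonzero⁻ : ∀ {k} (M : Mat k) → T (everyColNonzero M) → ColsNonzero (entry M)
everyColNonzero⁻ M p j = anyF⁻ (allF⁻ p j)

everyColNonzero⁺ : ∀ {k} (M : Mat k) → ColsNonzero (entry M) → T (everyColNonzero M)
everyColNonzero⁺ M p = allF⁺ λ j → anyF⁺ (p j)

module _ {prim : Bool} where

  rowWt : (a b : Val prim → Wt) → ∀ k → Vec (Val prim) (suc k) → Wt
  rowWt a b zero    (x ∷ []) = b x
  rowWt a b (suc k) (x ∷ xs) = a x ⊕ rowWt a b k xs

  rowNonzero : ∀ {k} → Vec (Val prim) k → Bool
  rowNonzero r = anyF λ j → nonzero (val (lookup r j))

  rawRowʷ : (a b : Val prim → Wt) → ℕ → Weighted
  Car (rawRowʷ a b k) = Vec (Val prim) (suc k)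
  wt (rawRowʷ a b k) = rowWt a b k

  rowʷ : (a b : Val prim → Wt) → ℕ → Weighted
  rowʷ a b k = subʷ (rawRowʷ a b k) rowNonzero

  consM : ∀ {k} → Vec (Val prim) (suc k) → MatV prim k → MatV prim (suc k)
  consM r V = r ∷ Vec.map (0ᵥ ∷_) V

  tailM : ∀ {k} → MatV prim (suc k) → MatV prim k
  tailM (r ∷ V) = Vec.map Vec.tail V

  tailM-consM : ∀ {k} r (V : MatV prim k) → tailM (consM r V) ≡ V
  tailM-consM r V = trans (sym (map-∘ _ _ V)) (map-id V)

  consM-tailM : ∀ {k} (V : MatV prim (suc k)) → UpperTriangular (entry (erase V)) → consM (Vec.head V) (tailM V) ≡ V
  consM-tailM (r ∷ V) ut = cong (r ∷_) (trans (sym (map-∘ _ _ V)) (map-id-where V λ i →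
    head-tail (lookup V i) (trans (sym (entry-erase (r ∷ V) (fsuc i) fzero)) (ut (fsuc i) fzero (s≤s z≤n)))))
    where
    head-tail : ∀ {k} (r : Vec (Val prim) (suc k)) → val (lookup r fzero) ≡ 0 → 0ᵥ ∷ Vec.tail r ≡ r
    head-tail (x ∷ r) e = cong (_∷ r) (Val-≡ (sym e))

  entry-consM-0 : ∀ {k} r (V : MatV prim k) j → entry (erase (consM r V)) fzero j ≡ val (lookup r j)
  entry-consM-0 r V j = lookup-map j val r

  entry-consM-suc-0 : ∀ {k} r (V : MatV prim k) i → entry (erase (consM r V)) (fsuc i) fzero ≡ 0
  entry-consM-suc-0 r V i = trans (entry-erase (consM r V) (fsuc i) fzero)
    (cong (λ s → val (lookup s fzero)) (lookup-map i (0ᵥ ∷_) V))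

  entry-consM-suc-suc : ∀ {k} r (V : MatV prim k) i j →
    entry (erase (consM r V)) (fsuc i) (fsuc j) ≡ entry (erase V) i j
  entry-consM-suc-suc r V i j = trans (entry-erase (consM r V) (fsuc i) (fsuc j))
    (trans (cong (λ s → val (lookup s (fsuc j))) (lookup-map i (0ᵥ ∷_) V)) (sym (entry-erase V i j)))

  rowFishburn-consM⁻ : ∀ {k} r (V : MatV prim k) → T (isRowFishburn (erase (consM r V))) →
    T (rowNonzero r) × T (isRowFishburn (erase V))
  rowFishburn-consM⁻ r V p with ut , rn ← T-∧⁻ {upperTriangular (erase (consM r V))} p =
    anyF⁺ first , T-∧⁺ (upperTriangular⁺ (erase V) ut′) (everyRowNonzero⁺ (erase V) rn′)
    where
    rows = everyRowNonzero⁻ (erase (consM r V)) rn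
    first : ∃ λ j → T (nonzero (val (lookup r j)))
    first with j , q ← rows fzero = j , subst (T ∘ nonzero) (entry-consM-0 r V j) q
    ut′ : UpperTriangular (entry (erase V))
    ut′ i j j<i = trans (sym (entry-consM-suc-suc r V i j)) (upperTriangular⁻ (erase (consM r V)) ut (fsuc i) (fsuc j) (s≤s j<i))
    rn′ : RowsNonzero (entry (erase V))
    rn′ i with rows (fsuc i)
    ... | fzero  , q = ⊥-elim (subst (T ∘ nonzero) (entry-consM-suc-0 r V i) q)
    ... | fsuc j , q = j , subst (T ∘ nonzero) (entry-consM-suc-suc r V i j) q

  rowFishburn-consM⁺ : ∀ {k} r (V : MatV prim k) → T (rowNonzero r) →
    T (isRowFishburn (erase V)) → T (isRowFishburn (erase (consM r V)))
  rowFishburn-consM⁺ r V p q with ut , rn ← T-∧⁻ {upperTriangular (erase V)} q =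
    T-∧⁺ (upperTriangular⁺ (erase (consM r V)) ut′) (everyRowNonzero⁺ (erase (consM r V)) rn′)
    where
    ut′ : UpperTriangular (entry (erase (consM r V)))
    ut′ (fsuc i) fzero    _         = entry-consM-suc-0 r V i
    ut′ (fsuc i) (fsuc j) (s≤s j<i) = trans (entry-consM-suc-suc r V i j) (upperTriangular⁻ (erase V) ut i j j<i)
    rn′ : RowsNonzero (entry (erase (consM r V)))
    rn′ fzero with j , x ← anyF⁻ p = j , subst (T ∘ nonzero) (sym (entry-consM-0 r V j)) x
    rn′ (fsuc i) with j , x ← everyRowNonzero⁻ (erase V) rn i =
      fsuc j , subst (T ∘ nonzero) (sym (entry-consM-suc-suc r V i j)) x

  matʷ-consM : ∀ (a b : Val prim → Wt) (st st′ : ∀ {k} → Mat k → Wt) k →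
    (∀ r (V : MatV prim k) → st (erase (consM r V)) ≡ rowWt a b k r ⊕ st′ (erase V)) →
    matʷ prim isRowFishburn st (suc k) ≅ rowʷ a b k ×ʷ matʷ prim isRowFishburn st′ k
  matʷ-consM a b st st′ k st-consM = ≅-sym (record
    { to = λ ((r , p) , V , q) → consM r V , rowFishburn-consM⁺ r V p q
    ; from = λ (V , p) → let q , r = rowFishburn-consM⁻ (Vec.head V) (tailM V) (subst (T ∘ isRowFishburn ∘ erase) (sym (eq V p)) p)
        in (Vec.head V , q) , tailM V , r
    ; to-from = λ (V , p) → Σ-≡ T-irrelevant (eq V p)
    ; from-to = λ ((r , p) , V , q) → cong₂ _,_ (Σ-≡ T-irrelevant refl) (Σ-≡ T-irrelevant (tailM-consM r V))
    ; wt-to = λ ((r , p) , V , q) → st-consM r V })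
    where
    eq : ∀ (V : MatV prim (suc k)) → T (isRowFishburn (erase V)) → consM (Vec.head V) (tailM V) ≡ V
    eq V p = consM-tailM V (upperTriangular⁻ (erase V) (proj₁ (T-∧⁻ p)))

  -- `Row` inserts new cells next to the last one, a vector grows at its head; `Row-⊗` mediates.
  rowʷ≅Row⁺ : ∀ sA sA-0 deg-sA sB sB-0 deg-sB k →
    rowʷ (sA ∘ val) (sB ∘ val) k ≅ (Row (valCell prim sA sA-0 deg-sA) k (valCell prim sB sB-0 deg-sB)) ⁺
  rowʷ≅Row⁺ sA sA-0 deg-sA sB sB-0 deg-sB k = subʷ-cong (raw≅ k) (nz-iso k)
    where
    A = valCell prim sA sA-0 deg-sA
    B = valCell prim sB sB-0 deg-sB
    raw≅ : ∀ k → rawRowʷ (sA ∘ val) (sB ∘ val) k ≅ typ (Row A k B)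
    raw≅ zero = record { to = Vec.head ; from = _∷ [] ; to-from = λ _ → refl
      ; from-to = λ { (x ∷ []) → refl } ; wt-to = λ { (x ∷ []) → refl } }
    raw≅ (suc k) = ≅-trans (record
      { to = λ { (x ∷ xs) → x , to (raw≅ k) xs }
      ; from = λ (x , r) → x ∷ from (raw≅ k) r
      ; to-from = λ (x , r) → cong (x ,_) (to-from (raw≅ k) r)
      ; from-to = λ { (x ∷ xs) → cong (x ∷_) (from-to (raw≅ k) xs) }
      ; wt-to = λ { (x ∷ xs) → cong (sA (val x) ⊕_) (wt-to (raw≅ k) xs) } })
      (iso-typ (≅ᶜ-sym (Row-⊗ A k A B)))
    nz-iso : ∀ k r → nz (Row A k B) (to (raw≅ k) r) ≡ rowNonzero r
    nz-iso zero    (x ∷ []) = sym (∨-identityʳ (nonzero (val x)))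
    nz-iso (suc k) (x ∷ xs) = trans (nz-to (≅ᶜ-sym (Row-⊗ A k A B)) (x , to (raw≅ k) xs))
      (cong (nonzero (val x) ∨_) (nz-iso k xs))

  sX sY sD sQ : Val prim → Wt
  sX x = val x , 0 , 0 , 0
  sY x = val x , val x , 0 , 0
  sD x = val x , 0 , val x , 0
  sQ x = val x , 0 , 0 , val x

  rowSum rowLast : ∀ k → Vec (Val prim) (suc k) → ℕ
  rowSum k r = sumF λ j → val (lookup r j)
  rowLast k r = val (lookup r (fromℕ k))

  rowWt-XY : ∀ k r → rowWt sX sY k r ≡ (rowSum k r , rowLast k r , 0 , 0)
  rowWt-XY zero    (x ∷ []) = Wt-≡ (sym (+-identityʳ _)) refl refl refl
  rowWt-XY (suc k) (x ∷ xs) rewrite rowWt-XY k xs = refl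

  rowWt-DQ : ∀ k r → rowWt sD sQ k r ≡ (rowSum k r , 0 , rowSum k r ∸ rowLast k r , rowLast k r)
  rowWt-DQ zero    (x ∷ []) = Wt-≡ (sym (+-identityʳ _)) refl
    (sym (trans (cong (_∸ val x) (+-identityʳ (val x))) (n∸n≡0 (val x)))) refl
  rowWt-DQ (suc k) (x ∷ xs) rewrite rowWt-DQ k xs = Wt-≡ refl refl
    (sym (+-∸-assoc (val x) (term≤sumF (λ j → val (lookup xs j)) (fromℕ k)))) refl

  size-consM : ∀ {k} r (V : MatV prim k) → size (erase (consM r V)) ≡ rowSum k r + size (erase V)
  size-consM r V = cong₂ _+_ (sumF-cong (entry-consM-0 r V)) (sumF-cong λ i →
    cong₂ _+_ (entry-consM-suc-0 r V i) (sumF-cong (entry-consM-suc-suc r V i)))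

  lastColSum-consM : ∀ {k} r (V : MatV prim k) → lastColSum (erase (consM r V)) ≡ rowLast k r + lastColSum (erase V)
  lastColSum-consM {zero}  r []  = cong (_+ 0) (entry-consM-0 r [] fzero)
  lastColSum-consM {suc k} r V = cong₂ _+_ (entry-consM-0 r V (fromℕ (suc k)))
    (sumF-cong λ i → entry-consM-suc-suc r V i (fromℕ k))

lastColWt statsRF : ∀ {k} → Mat k → Wt
lastColWt M = size M , lastColSum M , 0 , 0
statsRF M = size M , maxStat M , minStat M , iso M

module _ (prim : Bool) where
  open Fishburn (cellX prim) (cellD prim)
  private
    Y = cellY prim
    Q = cellQ prim

  mat≅Rows : ∀ k → matʷ prim isRowFishburn lastColWt k ≅ Rows k Y
  mat≅Rows zero = record { to = λ _ → tt ; from = λ _ → [] , tt ; to-from = λ _ → refl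
    ; from-to = λ { ([] , tt) → refl } ; wt-to = λ { ([] , tt) → refl } }
  mat≅Rows (suc k) = ≅-trans (matʷ-consM sX sY lastColWt lastColWt k eq)
    (×ʷ-cong (rowʷ≅Row⁺ _ _ _ _ _ _ k) (mat≅Rows k))
    where
    eq : ∀ r (V : MatV prim k) → lastColWt (erase (consM r V)) ≡ rowWt sX sY k r ⊕ lastColWt (erase V)
    eq r V rewrite rowWt-XY k r = Wt-≡ (size-consM r V) (lastColSum-consM r V) refl refl

  -- The corner lies in the first row, so max is the last column sum of the rows below, while min
  -- and iso belong to the first row alone.
  mat≅RowF : ∀ k → matʷ prim isRowFishburn statsRF (suc k) ≅ RowF k Y Q
  mat≅RowF k = ≅-trans (matʷ-consM sD sQ statsRF lastColWt k eq)
    (×ʷ-cong (rowʷ≅Row⁺ _ _ _ _ _ _ k) (mat≅Rows k))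
    where
    eq : ∀ r (V : MatV prim k) → statsRF (erase (consM r V)) ≡ rowWt sD sQ k r ⊕ lastColWt (erase V)
    eq r V rewrite rowWt-DQ k r = Wt-≡ (size-consM r V)
      (trans (cong₂ _∸_ (lastColSum-consM r V) corner) (m+n∸m≡n (rowLast k r) _))
      (trans (cong₂ _∸_ (sumF-cong (entry-consM-0 r V)) corner) (sym (+-identityʳ _)))
      (trans corner (sym (+-identityʳ _)))
      where corner = entry-consM-0 r V (fromℕ k)

-- Self-dual matrices from the outside in

data Code (k : ℕ) : Set where
  first last : Code k
  inner      : Fin k → Code k

idx : ∀ {k} → Code k → Fin (2 + k)
idx first     = fzero
idx (inner i) = fsuc (inject₁ i)
idx last      = fsuc (fromℕ _)

code : ∀ {k} → Fin (2 + k) → Code k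
code fzero = first
code {zero}  (fsuc fzero)     = last
code {suc k} (fsuc fzero)     = inner fzero
code {suc k} (fsuc (fsuc i)) with code {k} (fsuc i)
... | first   = first
... | inner j = inner (fsuc j)
... | last    = last

code-idx : ∀ {k} (a : Code k) → code (idx a) ≡ a
code-idx first = refl
code-idx {suc k} (inner fzero) = refl
code-idx {suc k} (inner (fsuc i)) rewrite code-idx (inner i) = refl
code-idx {zero}  last = refl
code-idx {suc k} last rewrite code-idx {k} last = refl

idx-code : ∀ {k} (i : Fin (2 + k)) → idx (code i) ≡ i
idx-code fzero = refl
idx-code {zero}  (fsuc fzero)    = refl
idx-code {suc k} (fsuc fzero)    = refl
idx-code {suc k} (fsuc (fsuc i)) with code {k} (fsuc i) | idx-code {k} (fsuc i)
... | inner j | e = cong fsuc e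
... | last    | e = cong fsuc e

-- Case analysis in step with `Col` and `Tri`, which peel off both ends at once, unlike `fzero` and
-- `fsuc`.
by-code : ∀ {k} (P : Fin (2 + k) → Set) → (∀ a → P (idx a)) → ∀ i → P i
by-code P p i = subst P (idx-code i) (p (code i))

by-codes : ∀ {k} (P : Fin (2 + k) → Fin (2 + k) → Set) → (∀ a b → P (idx a) (idx b)) → ∀ i j → P i j
by-codes P p i j = subst₂ P (idx-code i) (idx-code j) (p (code i) (code j))

toℕ-inner : ∀ {k} (i : Fin k) → toℕ (idx (inner i)) ≡ suc (toℕ i)
toℕ-inner i = cong suc (toℕ-inject₁ i)

toℕ-last : ∀ k → toℕ (idx {k} last) ≡ suc k
toℕ-last k = cong suc (toℕ-fromℕ k)

oppositeC : ∀ {k} → Code k → Code k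
oppositeC first     = last
oppositeC (inner i) = inner (opposite i)
oppositeC last      = first

opposite-inject₁ : ∀ {k} (i : Fin k) → opposite (inject₁ i) ≡ fsuc (opposite i)
opposite-inject₁ fzero    = refl
opposite-inject₁ (fsuc i) = cong inject₁ (opposite-inject₁ i)

opposite-fromℕ : ∀ k → opposite (fromℕ k) ≡ fzero
opposite-fromℕ zero    = refl
opposite-fromℕ (suc k) = cong inject₁ (opposite-fromℕ k)

opposite-idx : ∀ {k} (a : Code k) → opposite (idx a) ≡ idx (oppositeC a)
opposite-idx first     = refl
opposite-idx (inner i) = cong inject₁ (opposite-inject₁ i)
opposite-idx {k} last  = cong inject₁ (opposite-fromℕ k)

fillC : ∀ {A : Set} k → Col A k → Fin k → A
fillCode : ∀ {A : Set} k → Col A (2 + k) → Code k → A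
fillC (suc zero)    a  _ = a
fillC (suc (suc k)) as i = fillCode k as (code i)
fillCode k (a , _ , _)  first     = a
fillCode k (_ , b , _)  last      = b
fillCode k (_ , _ , as) (inner i) = fillC k as i

fillC-idx : ∀ {A : Set} k (as : Col A (2 + k)) a → fillC (2 + k) as (idx a) ≡ fillCode k as a
fillC-idx k as a = cong (fillCode k as) (code-idx a)

readC : ∀ {A : Set} k → (Fin k → A) → Col A k
readC zero          f = tt
readC (suc zero)    f = f fzero
readC (suc (suc k)) f = f (idx first) , f (idx last) , readC k (f ∘ idx ∘ inner)

readC-cong : ∀ {A : Set} k {f g : Fin k → A} → (∀ i → f i ≡ g i) → readC k f ≡ readC k g
readC-cong zero          e = refl
readC-cong (suc zero)    e = e fzero
readC-cong (suc (suc k)) e = cong₂ _,_ (e _) (cong₂ _,_ (e _) (readC-cong k (e ∘ idx ∘ inner)))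

readC-fillC : ∀ {A : Set} k (as : Col A k) → readC k (fillC k as) ≡ as
readC-fillC zero          _  = refl
readC-fillC (suc zero)    _  = refl
readC-fillC (suc (suc k)) as = cong₂ _,_ refl (cong₂ _,_ (fillC-idx k as last)
  (trans (readC-cong k (fillC-idx k as ∘ inner)) (readC-fillC k _)))

fillC-readC : ∀ {A : Set} k (f : Fin k → A) i → fillC k (readC k f) i ≡ f i
fillC-readC (suc zero)    f fzero = refl
fillC-readC (suc (suc k)) f = by-code _ λ a → trans (fillC-idx k _ a) (go a)
  where
  go : ∀ a → fillCode k (readC (2 + k) f) a ≡ f (idx a)
  go first     = refl
  go last      = refl
  go (inner i) = fillC-readC k _ i

fillC-mapC : ∀ {A B : Set} k (f : A → B) as i → fillC k (mapC k f as) i ≡ f (fillC k as i)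
fillC-mapC (suc zero)    f a  i = refl
fillC-mapC (suc (suc k)) f as i with code i
... | first   = refl
... | last    = refl
... | inner j = fillC-mapC k f _ j

fillC-zipC : ∀ {A B C : Set} k (f : A → B → C) as bs i → fillC k (zipC k f as bs) i ≡ f (fillC k as i) (fillC k bs i)
fillC-zipC (suc zero)    f a  b  i = refl
fillC-zipC (suc (suc k)) f as bs i with code i
... | first   = refl
... | last    = refl
... | inner j = fillC-zipC k f _ _ j

anyC⁻ : ∀ {A : Set} k (P : A → Bool) as → T (anyC k P as) → ∃ λ i → T (P (fillC k as i))
anyC⁻ (suc zero)    P a p = fzero , p
anyC⁻ (suc (suc k)) P (a , b , as) p with T-∨⁻ {P a} p
... | inj₁ q = idx first , q
... | inj₂ r with T-∨⁻ {P b} r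
...   | inj₁ q = idx last , subst (T ∘ P) (sym (fillC-idx k (a , b , as) last)) q
...   | inj₂ q with i , s ← anyC⁻ k P as q =
  idx (inner i) , subst (T ∘ P) (sym (fillC-idx k (a , b , as) (inner i))) s

anyC⁺ : ∀ {A : Set} k (P : A → Bool) as i → T (P (fillC k as i)) → T (anyC k P as)
anyC⁺ (suc zero)    P a i p = p
anyC⁺ (suc (suc k)) P (a , b , as) i p with code i
... | first   = T-∨⁺ (inj₁ p)
... | last    = T-∨⁺ {P a} (inj₂ (T-∨⁺ (inj₁ p)))
... | inner j = T-∨⁺ {P a} (inj₂ (T-∨⁺ {P b} (inj₂ (anyC⁺ k P as j p))))

-- Sums over diagonal and SE-cells, from the outside in

sumF-last : ∀ {k} (f : Fin (suc k) → ℕ) → sumF f ≡ f (fromℕ k) + sumF (f ∘ inject₁)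
sumF-last {zero}  f = refl
sumF-last {suc k} f = trans (cong (f fzero +_) (sumF-last (f ∘ fsuc)))
  (trans (sym (+-assoc (f fzero) _ _)) (trans (cong (_+ sumF (λ i → f (fsuc (inject₁ i)))) (+-comm (f fzero) _)) (+-assoc (f (fromℕ (suc k))) _ _)))

sumF-codes : ∀ {k} (f : Fin (2 + k) → ℕ) → sumF f ≡ f (idx first) + (f (idx last) + sumF (f ∘ idx ∘ inner))
sumF-codes f = cong (f fzero +_) (sumF-last (f ∘ fsuc))

sumF-+ : ∀ {k} (f g : Fin k → ℕ) → sumF (λ i → f i + g i) ≡ sumF f + sumF g
sumF-+ {zero}  f g = refl
sumF-+ {suc k} f g = trans (cong (f fzero + g fzero +_) (sumF-+ (f ∘ fsuc) (g ∘ fsuc)))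
  (solve 4 (λ a b c d → ((a ⊙ b) ⊙ (c ⊙ d)) ⊜ ((a ⊙ c) ⊙ (b ⊙ d))) refl (f fzero) (g fzero) (sumF (f ∘ fsuc)) (sumF (g ∘ fsuc)))
  where
  open CommutativeMonoidSolver +-0-commutativeMonoid using (solve; _⊜_) renaming (_⊕_ to _⊙_)

sumC-sumF : ∀ {A : Set} (π : Wt → ℕ) → (∀ v w → π (v ⊕ w) ≡ π v + π w) → π 𝟘 ≡ 0 →
  ∀ k (w : A → Wt) as → π (sumC k w as) ≡ sumF (λ i → π (w (fillC k as i)))
sumC-sumF π hom hom₀ zero          w _ = hom₀
sumC-sumF π hom hom₀ (suc zero)    w a = sym (+-identityʳ _)
sumC-sumF π hom hom₀ (suc (suc k)) w as@(a , b , cs) = trans (hom _ _) (trans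
  (cong (π (w a) +_) (trans (hom _ _) (cong₂ _+_ (cong (π ∘ w) (sym (fillC-idx k as last)))
    (trans (sumC-sumF π hom hom₀ k w cs) (sumF-cong λ i → cong (π ∘ w) (sym (fillC-idx k as (inner i))))))))
  (sym (sumF-codes (λ i → π (w (fillC (2 + k) as i))))))

selSum : ∀ k → (Fin k → Fin k → Bool) → (Fin k → Fin k → ℕ) → ℕ
selSum k b e = sumF λ i → sumF λ j → if b i j then e i j else 0

selSum-cong : ∀ k b {e e′ : Fin k → Fin k → ℕ} → (∀ i j → e i j ≡ e′ i j) → selSum k b e ≡ selSum k b e′
selSum-cong k b e≡ = sumF-cong λ i → sumF-cong λ j → cong (λ v → if b i j then v else 0) (e≡ i j)

if-0 : ∀ b → (if b then 0 else 0) ≡ 0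
if-0 true  = refl
if-0 false = refl

-- In the outer frame the corner is selected and the rest of the first row is not; the first column
-- and the last row vanish by triangularity, up to their diagonal ends. The rest of the last column
-- consists of SE-cells: `β` is false for the diagonal sum and true for the reduced size.
selSum-codes : ∀ k (b : Fin (2 + k) → Fin (2 + k) → Bool) (b′ : Fin k → Fin k → Bool) (β : Bool) e →
  b (idx first) (idx first) ≡ false → (∀ j → b (idx first) (idx (inner j)) ≡ false) → b (idx first) (idx last) ≡ true →
  (∀ i j → b (idx (inner i)) (idx (inner j)) ≡ b′ i j) →
  (∀ i → b (idx (inner i)) (idx last) ≡ β) → b (idx last) (idx last) ≡ β →
  UpperTriangular e →
  selSum (2 + k) b e ≡ e (idx first) (idx last) + ((if β then e (idx last) (idx last) else 0)
    + (sumF (λ i → if β then e (idx (inner i)) (idx last) else 0) + selSum k b′ (λ i j → e (idx (inner i)) (idx (inner j)))))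
selSum-codes k b b′ β e bFF bFI bFL bII bIL bLL ut = trans (sumF-codes row) (cong₂ _+_ rowF (cong₂ _+_ rowL rowsI))
  where
  cell : Fin (2 + k) → Fin (2 + k) → ℕ
  cell i j = if b i j then e i j else 0
  row : Fin (2 + k) → ℕ
  row i = sumF (cell i)
  zero-cell : ∀ i j → toℕ j < toℕ i → cell i j ≡ 0
  zero-cell i j j<i = trans (cong (λ v → if b i j then v else 0) (ut i j j<i)) (if-0 (b i j))
  pick : ∀ {c d : Bool} {v : ℕ} → c ≡ d → (if c then v else 0) ≡ (if d then v else 0)
  pick refl = refl
  rowF : row (idx first) ≡ e (idx first) (idx last)
  rowF = trans (sumF-codes (cell (idx first))) (trans (cong₂ _+_ (pick bFF) (cong₂ _+_ (pick bFL) (sumF-zero λ j → pick (bFI j))))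
    (+-identityʳ _))
  rowL : row (idx last) ≡ (if β then e (idx last) (idx last) else 0)
  rowL = trans (sumF-codes (cell (idx last))) (trans (cong₂ _+_ (zero-cell (idx last) (idx first) (s≤s z≤n))
    (cong₂ _+_ (pick bLL) (sumF-zero λ j → zero-cell (idx last) (idx (inner j))
      (subst₂ _<_ (sym (toℕ-inner j)) (sym (toℕ-last k)) (s≤s (toℕ<n j))))))
    (+-identityʳ _))
  rowI : ∀ i → row (idx (inner i)) ≡ (if β then e (idx (inner i)) (idx last) else 0)
    + sumF (λ j → if b′ i j then e (idx (inner i)) (idx (inner j)) else 0)
  rowI i = trans (sumF-codes (cell (idx (inner i)))) (cong₂ _+_ (zero-cell (idx (inner i)) (idx first) (s≤s z≤n))
    (cong₂ _+_ (pick (bIL i)) (sumF-cong λ j → pick (bII i j))))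
  rowsI : sumF (row ∘ idx ∘ inner) ≡ sumF (λ i → if β then e (idx (inner i)) (idx last) else 0)
    + selSum k b′ (λ i j → e (idx (inner i)) (idx (inner j)))
  rowsI = trans (sumF-cong rowI) (sumF-+ (λ i → if β then e (idx (inner i)) (idx last) else 0)
    (λ i → sumF λ j → if b′ i j then e (idx (inner i)) (idx (inner j)) else 0))

T⇒true : ∀ {b} → T b → b ≡ true
T⇒true {true} _ = refl

¬T⇒false : ∀ {b} → ¬ T b → b ≡ false
¬T⇒false {false} _  = refl
¬T⇒false {true}  ¬p = ⊥-elim (¬p tt)

<ᵇ-true : ∀ {m n} → m < n → (m <ᵇ n) ≡ true
<ᵇ-true m<n = T⇒true (<⇒<ᵇ m<n)

<ᵇ-false : ∀ {m n} → n ≤ m → (m <ᵇ n) ≡ false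
<ᵇ-false n≤m = ¬T⇒false λ p → ≤⇒≯ n≤m (<ᵇ⇒< _ _ p)

≡ᵇ-true : ∀ {m n} → m ≡ n → (m ≡ᵇ n) ≡ true
≡ᵇ-true e = T⇒true (≡⇒≡ᵇ _ _ e)

≡ᵇ-false : ∀ {m n} → m ≢ n → (m ≡ᵇ n) ≡ false
≡ᵇ-false m≢n = ¬T⇒false λ p → m≢n (≡ᵇ⇒≡ _ _ p)

-- Passing to the frame adds 2 to i + j and to the bound k + 1 alike, so the core keeps its diagonal
-- and SE-cells.
pos-inner² : ∀ {k} (i j : Fin k) → pos (idx (inner i)) + pos (idx (inner j)) ≡ 2 + (pos i + pos j)
pos-inner² i j rewrite toℕ-inject₁ i | toℕ-inject₁ j = cong (2 +_) (+-suc (toℕ i) (suc (toℕ j)))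

pos-inner-last : ∀ {k} (i : Fin k) → suc (2 + k) < pos (idx (inner i)) + pos (idx {k} last)
pos-inner-last {k} i rewrite toℕ-fromℕ k = s≤s (s≤s (m≤n+m (2 + k) (toℕ (inject₁ i))))

pos-last² : ∀ k → suc (2 + k) < pos (idx {k} last) + pos (idx {k} last)
pos-last² k rewrite toℕ-fromℕ k = s≤s (s≤s (m≤n+m (2 + k) k))

pos-first-inner : ∀ {k} (j : Fin k) → pos (idx {k} first) + pos (idx (inner j)) < suc (2 + k)
pos-first-inner j rewrite toℕ-inject₁ j = s≤s (s≤s (s≤s (toℕ<n j)))

diag-first-last : ∀ k → isDiagCell (idx {k} first) (idx last) ≡ true
diag-first-last k = ≡ᵇ-true (cong (3 +_) (toℕ-fromℕ k))

diag-first-inner : ∀ {k} (j : Fin k) → isDiagCell (idx first) (idx (inner j)) ≡ false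
diag-first-inner j = ≡ᵇ-false (<⇒≢ (pos-first-inner j))

diag-inner : ∀ {k} (i j : Fin k) → isDiagCell (idx (inner i)) (idx (inner j)) ≡ isDiagCell i j
diag-inner {k} i j = cong (_≡ᵇ suc (2 + k)) (pos-inner² i j)

SE-inner : ∀ {k} (i j : Fin k) → isSECell (idx (inner i)) (idx (inner j)) ≡ isSECell i j
SE-inner {k} i j = cong (suc (2 + k) <ᵇ_) (pos-inner² i j)

diagSum-codes : ∀ k e → UpperTriangular e → selSum (2 + k) isDiagCell e
  ≡ e (idx first) (idx last) + selSum k isDiagCell (λ i j → e (idx (inner i)) (idx (inner j)))
diagSum-codes k e ut = trans
  (selSum-codes k isDiagCell isDiagCell false e refl diag-first-inner (diag-first-last k) diag-inner
    (λ i → ≡ᵇ-false (<⇒≢ (pos-inner-last i) ∘ sym)) (≡ᵇ-false (<⇒≢ (pos-last² k) ∘ sym)) ut)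
  (cong (λ s → e (idx first) (idx last) + (s + selSum k isDiagCell (λ i j → e (idx (inner i)) (idx (inner j))))) (sumF-zero {k} λ _ → refl))

isRSCell : ∀ {k} → Fin k → Fin k → Bool
isRSCell i j = isDiagCell i j ∨ isSECell i j

rsSum-codes : ∀ k e → UpperTriangular e → selSum (2 + k) isRSCell e
  ≡ e (idx first) (idx last) + (e (idx last) (idx last)
    + (sumF (λ i → e (idx (inner i)) (idx last)) + selSum k isRSCell (λ i j → e (idx (inner i)) (idx (inner j)))))
rsSum-codes k e ut = selSum-codes k isRSCell isRSCell true e refl
  (λ j → cong₂ _∨_ (diag-first-inner j) (<ᵇ-false {suc (2 + k)} (≤-trans (m≤n+m _ 1) (pos-first-inner j))))
  (cong (_∨ isSECell (idx {k} first) (idx last)) (diag-first-last k))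
  (λ i j → cong₂ _∨_ (diag-inner i j) (SE-inner i j))
  (λ i → trans (cong (isDiagCell (idx (inner i)) (idx last) ∨_) (<ᵇ-true (pos-inner-last i))) (∨-zeroʳ _))
  (trans (cong (isDiagCell (idx {k} last) (idx last) ∨_) (<ᵇ-true (pos-last² k))) (∨-zeroʳ _)) ut

-- Rebuilding a self-dual matrix from its diagonal and SE-cells

module _ {prim : Bool} where

  TriV : ℕ → Set
  TriV k = Tri (Val prim) (Val prim) k (Val prim) (Val prim)

  -- The first row repeats the last column in reverse, as duality demands; the frame cells set to
  -- zero lie below the main diagonal.
  fill : ∀ k → TriV k → Fin k → Fin k → Val prim
  fillCodes : ∀ k → TriV (2 + k) → Code k → Code k → Val prim
  fill (suc zero)    z _ _ = z
  fill (suc (suc k)) t i j = fillCodes k t (code i) (code j)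
  fillCodes k (z , u , us , c) first     first     = u
  fillCodes k (z , u , us , c) first     (inner j) = fillC k us (opposite j)
  fillCodes k (z , u , us , c) first     last      = z
  fillCodes k (z , u , us , c) (inner i) first     = 0ᵥ
  fillCodes k (z , u , us , c) (inner i) (inner j) = fill k c i j
  fillCodes k (z , u , us , c) (inner i) last      = fillC k us i
  fillCodes k (z , u , us , c) last      first     = 0ᵥ
  fillCodes k (z , u , us , c) last      (inner j) = 0ᵥ
  fillCodes k (z , u , us , c) last      last      = u

  fill-idx : ∀ k t a b → fill (2 + k) t (idx a) (idx b) ≡ fillCodes k t a b
  fill-idx k t a b = cong₂ (fillCodes k t) (code-idx a) (code-idx b)

  read : ∀ k → (Fin k → Fin k → Val prim) → TriV k
  read zero          e = tt
  read (suc zero)    e = e fzero fzero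
  read (suc (suc k)) e = e (idx first) (idx last) , e (idx last) (idx last) ,
    readC k (λ i → e (idx (inner i)) (idx last)) , read k (λ i j → e (idx (inner i)) (idx (inner j)))

  read-cong : ∀ k {e e′ : Fin k → Fin k → Val prim} → (∀ i j → e i j ≡ e′ i j) → read k e ≡ read k e′
  read-cong zero          p = refl
  read-cong (suc zero)    p = p fzero fzero
  read-cong (suc (suc k)) p = cong₂ _,_ (p _ _) (cong₂ _,_ (p _ _)
    (cong₂ _,_ (readC-cong k λ i → p _ _) (read-cong k λ i j → p _ _)))

  read-fill : ∀ k t → read k (fill k t) ≡ t
  read-fill zero          t = refl
  read-fill (suc zero)    t = refl
  read-fill (suc (suc k)) t@(z , u , us , c) = cong₂ _,_ (fill-idx k t first last)
    (cong₂ _,_ (fill-idx k t last last) (cong₂ _,_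
      (trans (readC-cong k λ i → fill-idx k t (inner i) last) (readC-fillC k us))
      (trans (read-cong k λ i j → fill-idx k t (inner i) (inner j)) (read-fill k c))))

  SelfDualV UpperTriangularV : ∀ {k} → (Fin k → Fin k → Val prim) → Set
  SelfDualV e = ∀ i j → e i j ≡ e (opposite j) (opposite i)
  UpperTriangularV e = ∀ i j → toℕ j < toℕ i → e i j ≡ 0ᵥ

  inner<inner : ∀ {k} {i j : Fin k} → toℕ j < toℕ i → toℕ (idx (inner j)) < toℕ (idx (inner i))
  inner<inner {i = i} {j} j<i = subst₂ _<_ (sym (toℕ-inner j)) (sym (toℕ-inner i)) (s≤s j<i)

  inner<last : ∀ {k} (j : Fin k) → toℕ (idx (inner j)) < toℕ (idx {k} last)
  inner<last {k} j = subst₂ _<_ (sym (toℕ-inner j)) (sym (toℕ-last k)) (s≤s (toℕ<n j))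

  -- The cells that `read` skips are recovered from duality in the first row, and from triangularity
  -- in the first column and the last row.
  fill-read : ∀ k e → UpperTriangularV e → SelfDualV e → ∀ i j → fill k (read k e) i j ≡ e i j
  fill-read (suc zero)    e ut sd fzero fzero = refl
  fill-read (suc (suc k)) e ut sd = by-codes _ λ a b → trans (fill-idx k _ a b) (go a b)
    where
    sd-idx : ∀ a b → e (idx a) (idx b) ≡ e (idx (oppositeC b)) (idx (oppositeC a))
    sd-idx a b = trans (sd (idx a) (idx b)) (cong₂ e (opposite-idx b) (opposite-idx a))
    go : ∀ a b → fillCodes k (read (2 + k) e) a b ≡ e (idx a) (idx b)
    go first     first     = sym (sd-idx first first)
    go first     (inner j) = trans (fillC-readC k _ (opposite j)) (sym (sd-idx first (inner j)))
    go first     last      = refl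
    go (inner i) first     = sym (ut _ _ (s≤s z≤n))
    go (inner i) (inner j) = fill-read k _ (λ i j j<i → ut _ _ (inner<inner j<i)) (λ i j → sd-idx (inner i) (inner j)) i j
    go (inner i) last      = fillC-readC k _ i
    go last      first     = sym (ut _ _ (s≤s z≤n))
    go last      (inner j) = sym (ut _ _ (inner<last j))
    go last      last      = refl

  fill-upperTriangular : ∀ k t → UpperTriangularV (fill k t)
  fill-upperTriangular (suc zero)    t fzero fzero ()
  fill-upperTriangular (suc (suc k)) t = by-codes _ λ a b b<a → trans (fill-idx k t a b) (go a b b<a)
    where
    go : ∀ a b → toℕ (idx b) < toℕ (idx a) → fillCodes k t a b ≡ 0ᵥ
    go first     b         ()
    go (inner i) first     _   = refl
    go (inner i) (inner j) b<a = fill-upperTriangular k _ i j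
      (≤-pred (subst₂ _<_ (toℕ-inner j) (toℕ-inner i) b<a))
    go (inner i) last      b<a = ⊥-elim (<-asym b<a (inner<last i))
    go last      first     _   = refl
    go last      (inner j) _   = refl
    go last      last      b<a = ⊥-elim (<-irrefl refl b<a)

  fill-selfDual : ∀ k t → SelfDualV (fill k t)
  fill-selfDual (suc zero)    t i j = refl
  fill-selfDual (suc (suc k)) t = by-codes _ λ a b → trans (fill-idx k t a b) (trans (go a b)
    (trans (sym (fill-idx k t (oppositeC b) (oppositeC a))) (sym (cong₂ (fill (2 + k) t) (opposite-idx b) (opposite-idx a)))))
    where
    us = proj₁ (proj₂ (proj₂ t))
    go : ∀ a b → fillCodes k t a b ≡ fillCodes k t (oppositeC b) (oppositeC a)
    go first     first     = refl
    go first     (inner j) = refl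
    go first     last      = refl
    go (inner i) first     = refl
    go (inner i) (inner j) = fill-selfDual k _ i j
    go (inner i) last      = cong (fillC k us) (sym (opposite-involutive i))
    go last      first     = refl
    go last      (inner j) = refl
    go last      last      = refl

  nzV : Val prim → Bool
  nzV = nonzero ∘ val

  open SelfDual (cellX prim) (cellD prim) using (goodCore)

  -- The entries of `es` are indexed by the enclosing last column; the cell above column `j` is dual
  -- to its entry at `opposite j`.
  ColumnOK : ∀ k → TriV k → Col Bool k → Fin k → Set
  ColumnOK k c es j = (∃ λ i → T (nzV (fill k c i j))) ⊎ T (fillC k es (opposite j))

  -- The first conjunct concerns the first column, whose only cell is dual to `x` and has `e′` above
  -- it; the second concerns the last column, with `e` above it. For the inner columns the first
  -- row, dual to `xs`, joins the cells above.
  goodCore⁻ : ∀ k c es → T (goodCore k c es) → ∀ j → ColumnOK k c es j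
  goodCore⁻ (suc zero) d e p fzero with T-∨⁻ {nzV d} p
  ... | inj₁ q = inj₁ (fzero , q)
  ... | inj₂ q = inj₂ q
  goodCore⁻ (suc (suc k)) t@(d , x , xs , c) ees@(e , e′ , es) p = by-code _ column
    where
    p₁ = proj₁ (T-∧⁻ {nzV x ∨ e′} p)
    p₂₃ = T-∧⁻ {(nzV d ∨ e) ∨ (nzV x ∨ anyC k nzV xs)} (proj₂ (T-∧⁻ {nzV x ∨ e′} p))
    at : ∀ a b → T (nzV (fillCodes k t a b)) → ColumnOK (2 + k) t ees (idx b)
    at a b q = inj₁ (idx a , subst (T ∘ nzV) (sym (fill-idx k t a b)) q)
    above : ∀ b → T (fillCode k ees (oppositeC b)) → ColumnOK (2 + k) t ees (idx b)
    above b q = inj₂ (subst T (sym (trans (cong (fillC (2 + k) ees) (opposite-idx b)) (fillC-idx k ees (oppositeC b)))) q)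
    column : ∀ b → ColumnOK (2 + k) t ees (idx b)
    column first with T-∨⁻ {nzV x} p₁
    ... | inj₁ q = at first first q
    ... | inj₂ q = above first q
    column last with T-∨⁻ {nzV d ∨ e} (proj₁ p₂₃)
    ... | inj₁ q with T-∨⁻ {nzV d} q
    ...   | inj₁ r = at first last r
    ...   | inj₂ r = above last r
    column last | inj₂ q with T-∨⁻ {nzV x} q
    ...   | inj₁ r = at last last r
    ...   | inj₂ r with i , s ← anyC⁻ k nzV xs r = at (inner i) last s
    column (inner j) with goodCore⁻ k c _ (proj₂ p₂₃) j
    ... | inj₁ (i , q) = at (inner i) (inner j) q
    ... | inj₂ q with T-∨⁻ (subst T (fillC-zipC k _∨_ (mapC k nzV xs) es (opposite j)) q)
    ...   | inj₁ r = at first (inner j) (subst T (fillC-mapC k nzV xs (opposite j)) r)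
    ...   | inj₂ r = above (inner j) r

  goodCore⁺ : ∀ k c es → (∀ j → ColumnOK k c es j) → T (goodCore k c es)
  goodCore⁺ zero       c es p = tt
  goodCore⁺ (suc zero) d e  p with p fzero
  ... | inj₁ (_ , q) = T-∨⁺ (inj₁ q)
  ... | inj₂ q       = T-∨⁺ {nzV d} (inj₂ q)
  goodCore⁺ (suc (suc k)) t@(d , x , xs , c) ees@(e , e′ , es) p =
    T-∧⁺ {nzV x ∨ e′} firstOK (T-∧⁺ {(nzV d ∨ e) ∨ (nzV x ∨ anyC k nzV xs)} lastOK (goodCore⁺ k c _ innerOK))
    where
    column : ∀ b → (∃ λ a → T (nzV (fillCodes k t a b))) ⊎ T (fillCode k ees (oppositeC b))
    column b with p (idx b)
    ... | inj₁ (i , q) = inj₁ (code i , subst (λ c → T (nzV (fillCodes k t (code i) c))) (code-idx b) q)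
    ... | inj₂ q = inj₂ (subst T (trans (cong (fillC (2 + k) ees) (opposite-idx b)) (fillC-idx k ees (oppositeC b))) q)
    firstOK : T (nzV x ∨ e′)
    firstOK with column first
    ... | inj₁ (first , q) = T-∨⁺ (inj₁ q)
    ... | inj₂ q = T-∨⁺ {nzV x} (inj₂ q)
    lastOK : T ((nzV d ∨ e) ∨ (nzV x ∨ anyC k nzV xs))
    lastOK with column last
    ... | inj₁ (first , q)   = T-∨⁺ (inj₁ (T-∨⁺ (inj₁ q)))
    ... | inj₁ (last , q)    = T-∨⁺ {nzV d ∨ e} (inj₂ (T-∨⁺ (inj₁ q)))
    ... | inj₁ (inner i , q) = T-∨⁺ {nzV d ∨ e} (inj₂ (T-∨⁺ {nzV x} (inj₂ (anyC⁺ k nzV xs i q))))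
    ... | inj₂ q             = T-∨⁺ (inj₁ (T-∨⁺ {nzV d} (inj₂ q)))
    innerOK : ∀ j → ColumnOK k c (zipC k _∨_ (mapC k nzV xs) es) j
    innerOK j with column (inner j)
    ... | inj₁ (inner i , q) = inj₁ (i , q)
    ... | inj₁ (first , q)   = inj₂ (subst T (sym (fillC-zipC k _∨_ (mapC k nzV xs) es (opposite j)))
            (T-∨⁺ (inj₁ (subst T (sym (fillC-mapC k nzV xs (opposite j))) q))))
    ... | inj₂ q             = inj₂ (subst T (sym (fillC-zipC k _∨_ (mapC k nzV xs) es (opposite j)))
            (T-∨⁺ {fillC k (mapC k nzV xs) (opposite j)} (inj₂ q)))

-- Self-dual Fishburn matrices as a weighted type

isSelfDualFishburn : ∀ {k} → Mat k → Bool
isSelfDualFishburn M = isFishburn M ∧ isSelfDual M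

statsSD : ∀ {k} → Mat k → Wt
statsSD M = rs M , maxStat M , dg M , iso M

module _ (prim : Bool) where
  private
    X = cellX prim
    Y = cellY prim
    D = cellD prim
    Q = cellQ prim
  open SelfDual X D

  fillℕ : ∀ k → TriV {prim} k → Fin k → Fin k → ℕ
  fillℕ k t i j = val (fill k t i j)

  good⁻ : ∀ k t → T (good (suc k) Y Q t) → ColsNonzero (fillℕ (suc k) t)
  good⁻ zero    z p _ = fzero , p
  good⁻ (suc k) t@(z , u , us , c) p = by-code _ column
    where
    at : ∀ a b → T (nzV (fillCodes k t a b)) → ∃ λ i → T (nonzero (fillℕ (2 + k) t i (idx b)))
    at a b q = idx a , subst (T ∘ nzV) (sym (fill-idx k t a b)) q
    column : ∀ b → ∃ λ i → T (nonzero (fillℕ (2 + k) t i (idx b)))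
    column first = at first first (proj₁ (T-∧⁻ p))
    column last  = at last last (proj₁ (T-∧⁻ p))
    column (inner j) with goodCore⁻ k c _ (proj₂ (T-∧⁻ {nzV u} p)) j
    ... | inj₁ (i , q) = at (inner i) (inner j) q
    ... | inj₂ q       = at first (inner j) (subst T (fillC-mapC k nzV us (opposite j)) q)

  good⁺ : ∀ k t → ColsNonzero (fillℕ (suc k) t) → T (good (suc k) Y Q t)
  good⁺ zero    z p = proj₂ (p fzero)
  good⁺ (suc k) t@(z , u , us , c) p = T-∧⁺ firstOK (goodCore⁺ k c _ innerOK)
    where
    column : ∀ b → ∃ λ a → T (nzV (fillCodes k t a b))
    column b with i , q ← p (idx b) = code i , subst (λ c → T (nzV (fillCodes k t (code i) c))) (code-idx b) q
    firstOK : T (nzV u)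
    firstOK with first , q ← column first = q
    innerOK : ∀ j → ColumnOK k c (mapC k nzV us) j
    innerOK j with column (inner j)
    ... | inner i , q = inj₁ (i , q)
    ... | first , q   = inj₂ (subst T (sym (fillC-mapC k nzV us (opposite j))) q)

  matrix : ∀ k → TriV {prim} k → MatV prim k
  matrix k t = tabulate λ i → tabulate (fill k t i)

  cells : ∀ {k} → MatV prim k → Fin k → Fin k → Val prim
  cells V i j = lookup (lookup V i) j

  cells-matrix : ∀ k t i j → cells (matrix k t) i j ≡ fill k t i j
  cells-matrix k t i j = trans (cong (λ r → lookup r j) (lookup∘tabulate (λ i → tabulate (fill k t i)) i)) (lookup∘tabulate (fill k t i) j)

  entry-matrix : ∀ k t i j → entry (erase (matrix k t)) i j ≡ fillℕ k t i j
  entry-matrix k t i j = trans (entry-erase (matrix k t) i j) (cong val (cells-matrix k t i j))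

  read-matrix : ∀ k t → read k (cells (matrix k t)) ≡ t
  read-matrix k t = trans (read-cong k (cells-matrix k t)) (read-fill k t)

  selfDual⁻ : ∀ {k} (V : MatV prim k) → T (isSelfDual (erase V)) → SelfDualV (cells V)
  selfDual⁻ V p i j = Val-≡ (trans (sym (entry-erase V i j)) (trans
    (≡ᵇ⇒≡ _ _ (allF⁻ (allF⁻ p i) j)) (entry-erase V (opposite j) (opposite i))))

  matrix-read : ∀ k (V : MatV prim k) → T (isSelfDualFishburn (erase V)) → matrix k (read k (cells V)) ≡ V
  matrix-read k V p = trans (tabulate-cong λ i → trans (tabulate-cong λ j → fill-read k (cells V) ut (selfDual⁻ V sd) i j)
      (tabulate∘lookup (lookup V i))) (tabulate∘lookup V)
    where
    sd = proj₂ (T-∧⁻ {isFishburn (erase V)} p)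
    ut : UpperTriangularV (cells V)
    ut i j j<i = Val-≡ (trans (sym (entry-erase V i j))
      (upperTriangular⁻ (erase V) (proj₁ (T-∧⁻ (proj₁ (T-∧⁻ {isFishburn (erase V)} p)))) i j j<i))

  good⇒Fishburn : ∀ k t → T (good (suc k) Y Q t) → T (isSelfDualFishburn (erase (matrix (suc k) t)))
  good⇒Fishburn k t g = T-∧⁺ (T-∧⁺ ut (T-∧⁺ (everyRowNonzero⁺ M rows) (everyColNonzero⁺ M cols))) sd
    where
    M = erase (matrix (suc k) t)
    e = fillℕ (suc k) t
    e≡ = entry-matrix (suc k) t
    ut : T (upperTriangular M)
    ut = upperTriangular⁺ M λ i j j<i → trans (e≡ i j) (cong val (fill-upperTriangular (suc k) t i j j<i))
    sd′ : ∀ i j → entry M i j ≡ entry M (opposite j) (opposite i)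
    sd′ i j = trans (e≡ i j) (trans (cong val (fill-selfDual (suc k) t i j)) (sym (e≡ (opposite j) (opposite i))))
    sd : T (isSelfDual M)
    sd = allF⁺ λ i → allF⁺ λ j → ≡⇒≡ᵇ _ _ (sd′ i j)
    cols : ColsNonzero (entry M)
    cols j with i , q ← good⁻ k t g j = i , subst (T ∘ nonzero) (sym (e≡ i j)) q
    rows : RowsNonzero (entry M)
    -- A nonzero cell of the column dual to row `i` is reflected into row `i`.
    rows i with r , q ← cols (opposite i) = opposite r ,
      subst (T ∘ nonzero) (trans (sd′ r (opposite i)) (cong (λ l → entry M l (opposite r)) (opposite-involutive i))) q

  Fishburn⇒good : ∀ k t → T (isSelfDualFishburn (erase (matrix (suc k) t))) → T (good (suc k) Y Q t)
  Fishburn⇒good k t p = good⁺ k t λ j → let i , q = cols j in i , subst (T ∘ nonzero) (entry-matrix (suc k) t i j) q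
    where
    M = erase (matrix (suc k) t)
    cols : ColsNonzero (entry M)
    cols = everyColNonzero⁻ M (proj₂ (T-∧⁻ {everyRowNonzero M} (proj₂ (T-∧⁻ {upperTriangular M} (proj₁ (T-∧⁻ {isFishburn M} p))))))

  fillℕ-upperTriangular : ∀ k t → UpperTriangular (fillℕ k t)
  fillℕ-upperTriangular k t i j j<i = cong val (fill-upperTriangular k t i j j<i)

  -- Stated for arbitrary weights because the recursion passes from the outer cells Y and Q to the
  -- cells X and D of the core.
  deg-triʷ : ∀ sU sU-0 deg-sU sZ sZ-0 deg-sZ k t →
    deg (wt (triʷ k (valCell prim sU sU-0 deg-sU) (valCell prim sZ sZ-0 deg-sZ)) t) ≡ selSum k isRSCell (fillℕ k t)
  deg-triʷ sU _ deg-sU sZ _ deg-sZ zero       t = refl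
  deg-triʷ sU _ deg-sU sZ _ deg-sZ (suc zero) z = trans (deg-sZ (val z)) (sym (trans (+-identityʳ _) (+-identityʳ _)))
  deg-triʷ sU _ deg-sU sZ _ deg-sZ (suc (suc k)) t@(z , u , us , c) = trans
    (cong₂ _+_ (trans (deg-sZ (val z)) (cong val (sym (fill-idx k t first last))))
      (cong₂ _+_ (trans (deg-sU (val u)) (cong val (sym (fill-idx k t last last))))
        (cong₂ _+_ (trans (sumC-sumF deg (λ _ _ → refl) refl k (sU ∘ val) us)
            (sumF-cong λ i → trans (deg-sU _) (cong val (sym (fill-idx k t (inner i) last)))))
          (trans (deg-triʷ _ refl (λ _ → refl) _ refl (λ _ → refl) k c)
            (selSum-cong k isRSCell λ i j → cong val (sym (fill-idx k t (inner i) (inner j))))))))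
    (sym (rsSum-codes k (fillℕ (2 + k) t) (fillℕ-upperTriangular (2 + k) t)))

  diagSum-idx : ∀ k t → selSum (2 + k) isDiagCell (fillℕ (2 + k) t)
    ≡ val (proj₁ t) + selSum k isDiagCell (fillℕ k (proj₂ (proj₂ (proj₂ t))))
  diagSum-idx k t = trans (diagSum-codes k (fillℕ (2 + k) t) (fillℕ-upperTriangular (2 + k) t))
    (cong₂ _+_ (cong val (fill-idx k t first last)) (selSum-cong k isDiagCell λ i j → cong val (fill-idx k t (inner i) (inner j))))

  st₂-core : ∀ k c → st₂ (wt (triʷ k X D) c) ≡ 0
  st₂-core zero          c = refl
  st₂-core (suc zero)    c = refl
  st₂-core (suc (suc k)) (_ , _ , xs , c) = cong₂ _+_ (trans (sumC-sumF st₂ (λ _ _ → refl) refl k (wt (typ X)) xs) (sumF-zero {k} λ _ → refl)) (st₂-core k c)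

  st₄-core : ∀ k c → st₄ (wt (triʷ k X D) c) ≡ 0
  st₄-core zero          c = refl
  st₄-core (suc zero)    c = refl
  st₄-core (suc (suc k)) (_ , _ , xs , c) = cong₂ _+_ (trans (sumC-sumF st₄ (λ _ _ → refl) refl k (wt (typ X)) xs) (sumF-zero {k} λ _ → refl)) (st₄-core k c)

  st₃-core : ∀ k c → st₃ (wt (triʷ k X D) c) ≡ selSum k isDiagCell (fillℕ k c)
  st₃-core zero          c = refl
  st₃-core (suc zero)    d = sym (trans (+-identityʳ _) (+-identityʳ _))
  st₃-core (suc (suc k)) t@(d , _ , xs , c) = trans
    (cong (val d +_) (cong₂ _+_ (trans (sumC-sumF st₃ (λ _ _ → refl) refl k (wt (typ X)) xs) (sumF-zero {k} λ _ → refl)) (st₃-core k c)))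
    (sym (diagSum-idx k t))

  iso-matrix : ∀ k t → iso (erase (matrix (suc k) t)) ≡ st₄ (wt (triʷ (suc k) Y Q) t)
  iso-matrix zero    z = refl
  iso-matrix (suc k) t@(z , u , us , c) = trans (entry-matrix (2 + k) t (idx first) (idx last))
    (trans (cong val (fill-idx k t first last)) (sym (trans (cong (val z +_) (cong₂ _+_
      (trans (sumC-sumF st₄ (λ _ _ → refl) refl k (wt (typ Y)) us) (sumF-zero {k} λ _ → refl)) (st₄-core k c))) (+-identityʳ _))))

  rs-matrix : ∀ k t → rs (erase (matrix (suc k) t)) ≡ deg (wt (triʷ (suc k) Y Q) t)
  rs-matrix k t = trans (selSum-cong (suc k) isRSCell (entry-matrix (suc k) t))
    (sym (deg-triʷ _ refl (λ _ → refl) _ refl (λ _ → refl) (suc k) t))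

  iso-val : ∀ k t → iso (erase (matrix (2 + k) t)) ≡ val (proj₁ t)
  iso-val k t = trans (entry-matrix (2 + k) t (idx first) (idx last)) (cong val (fill-idx k t first last))

  dg-matrix : ∀ k t → dg (erase (matrix (suc k) t)) ≡ st₃ (wt (triʷ (suc k) Y Q) t)
  dg-matrix zero    z = trans (cong (_∸ val z) (trans (+-identityʳ _) (+-identityʳ _))) (n∸n≡0 (val z))
  dg-matrix (suc k) t@(z , u , us , c) = trans
    (cong₂ _∸_ (trans (selSum-cong (2 + k) isDiagCell (entry-matrix (2 + k) t)) (diagSum-idx k t)) (iso-val k t))
    (trans (m+n∸m≡n (val z) _) (sym (cong₂ _+_
      (trans (sumC-sumF st₃ (λ _ _ → refl) refl k (wt (typ Y)) us) (sumF-zero {k} λ _ → refl)) (st₃-core k c))))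

  max-matrix : ∀ k t → maxStat (erase (matrix (suc k) t)) ≡ st₂ (wt (triʷ (suc k) Y Q) t)
  max-matrix zero    z = trans (cong (_∸ val z) (+-identityʳ _)) (n∸n≡0 (val z))
  max-matrix (suc k) t@(z , u , us , c) = trans
    (cong₂ _∸_ (trans (sumF-cong λ i → entry-matrix (2 + k) t i (idx last)) (trans (sumF-codes (λ i → fillℕ (2 + k) t i (idx last)))
      (cong₂ _+_ (cong val (fill-idx k t first last)) (cong₂ _+_ (cong val (fill-idx k t last last))
        (trans (sumF-cong λ i → cong val (fill-idx k t (inner i) last)) (sym (sumC-sumF st₂ (λ _ _ → refl) refl k (wt (typ Y)) us)))))))
      (iso-val k t))
    (trans (m+n∸m≡n (val z) _) (cong (val u +_) (sym (trans (cong (st₂ (sumC k (wt (typ Y)) us) +_) (st₂-core k c)) (+-identityʳ _)))))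

  mat≅SD : ∀ k → matʷ prim isSelfDualFishburn statsSD (suc k) ≅ SD (suc k) Y Q
  mat≅SD k = ≅-sym (record
    { to = λ (t , g) → matrix (suc k) t , good⇒Fishburn k t g
    ; from = λ (V , p) → read (suc k) (cells V) ,
        Fishburn⇒good k _ (subst (T ∘ isSelfDualFishburn ∘ erase) (sym (matrix-read (suc k) V p)) p)
    ; to-from = λ (V , p) → Σ-≡ T-irrelevant (matrix-read (suc k) V p)
    ; from-to = λ (t , g) → Σ-≡ T-irrelevant (read-matrix (suc k) t)
    ; wt-to = λ (t , g) → Wt-≡ (rs-matrix k t) (max-matrix k t) (dg-matrix k t) (iso-matrix k t) })

-- Relations between the statistics

corner-diag : ∀ k → T (isDiagCell {suc k} fzero (fromℕ k))
corner-diag k = ≡⇒≡ᵇ _ _ (cong (2 +_) (toℕ-fromℕ k))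

-- The corner is a summand of the last column, so the truncated subtraction in `maxStat` is exact.
maxStat+iso : ∀ {k} (M : Mat k) → maxStat M + iso M ≡ lastColSum M
maxStat+iso {zero}  M = refl
maxStat+iso {suc k} M = m∸n+n≡m (term≤sumF (λ i → entry M i (fromℕ k)) fzero)

minStat+iso : ∀ {k} (M : Mat (suc k)) → minStat M + iso M ≡ sumF (entry M fzero)
minStat+iso {k} M = m∸n+n≡m (term≤sumF (entry M fzero) (fromℕ k))

diagTerm≤ : ∀ {k} (M : Mat k) i j → T (isDiagCell i j) → entry M i j ≤ selSum k isDiagCell (entry M)
diagTerm≤ M i j d = ≤-trans (subst (λ b → entry M i j ≤ (if b then entry M i j else 0)) (sym (T⇒true d)) ≤-refl)
  (≤-trans (term≤sumF (λ j → if isDiagCell i j then entry M i j else 0) j)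
    (term≤sumF (λ i → sumF λ j → if isDiagCell i j then entry M i j else 0) i))

dg+iso : ∀ {k} (M : Mat k) → dg M + iso M ≡ selSum k isDiagCell (entry M)
dg+iso {zero}  M = refl
dg+iso {suc k} M = m∸n+n≡m (diagTerm≤ M fzero (fromℕ k) (corner-diag k))

allDiagZero⇒ : ∀ {k} (M : Mat k) → T (allDiagZero M) → dg M + iso M ≡ 0
allDiagZero⇒ {k} M p = trans (dg+iso M) (sumF-zero λ i → sumF-zero λ j →
  vanish (isDiagCell i j) (allF⁻ {f = test i} (allF⁻ {f = λ i → allF (test i)} p i) j))
  where
  test : Fin k → Fin k → Bool
  test i j = if isDiagCell i j then entry M i j ≡ᵇ 0 else true
  vanish : ∀ b {v} → T (if b then v ≡ᵇ 0 else true) → (if b then v else 0) ≡ 0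
  vanish true  q = ≡ᵇ⇒≡ _ 0 q
  vanish false q = refl

⇒allDiagZero : ∀ {k} (M : Mat k) → dg M + iso M ≡ 0 → T (allDiagZero M)
⇒allDiagZero M p = allF⁺ λ i → allF⁺ λ j → T-if {isDiagCell i j} λ d →
  ≡⇒≡ᵇ _ 0 (n≤0⇒n≡0 (subst (entry M i j ≤_) (trans (sym (dg+iso M)) p) (diagTerm≤ M i j d)))

first-row-positive : ∀ {k} (M : Mat (suc k)) → T (isRowFishburn M) → 1 ≤ minStat M + iso M
first-row-positive M p with j , q ← everyRowNonzero⁻ M (proj₂ (T-∧⁻ {upperTriangular M} p)) fzero =
  subst (1 ≤_) (sym (minStat+iso M)) (≤-trans (positive q) (term≤sumF (entry M fzero) j))
  where
  positive : ∀ {v} → T (nonzero v) → 1 ≤ v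
  positive {suc v} _ = s≤s z≤n

-- The families as fibres

module _ (prim : Bool) where
  private
    Y = cellY prim
    Q = cellQ prim
  open Fishburn (cellX prim) (cellD prim)
  open SelfDual (cellX prim) (cellD prim)

  SDstats⁻ : ∀ n m p q {k} (M : Mat k) → T (SDstats prim n m p q M) →
    T (isSelfDualFishburn M) × statsSD M ≡ (n , m , p , q) × T (primOK prim M)
  SDstats⁻ n m p q M h =
    let f , h = T-∧⁻ {isFishburn M} h ; s , h = T-∧⁻ {isSelfDual M} h ; a , h = T-∧⁻ {rs M ≡ᵇ n} h
        b , h = T-∧⁻ {maxStat M ≡ᵇ m} h ; c , h = T-∧⁻ {dg M ≡ᵇ p} h ; d , h = T-∧⁻ {iso M ≡ᵇ q} h
    in T-∧⁺ f s , Wt-≡ (≡ᵇ⇒≡ _ _ a) (≡ᵇ⇒≡ _ _ b) (≡ᵇ⇒≡ _ _ c) (≡ᵇ⇒≡ _ _ d) , h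

  SDstats⁺ : ∀ n m p q {k} (M : Mat k) → T (isSelfDualFishburn M) → statsSD M ≡ (n , m , p , q) →
    T (primOK prim M) → T (SDstats prim n m p q M)
  SDstats⁺ n m p q M f e h =
    let f , s = T-∧⁻ {isFishburn M} f in
    T-∧⁺ f (T-∧⁺ s (T-∧⁺ (≡⇒≡ᵇ _ _ (cong deg e)) (T-∧⁺ (≡⇒≡ᵇ _ _ (cong st₂ e))
      (T-∧⁺ (≡⇒≡ᵇ _ _ (cong st₃ e)) (T-∧⁺ (≡⇒≡ᵇ _ _ (cong st₄ e)) h)))))

  RFstats⁻ : ∀ n m p q {k} (M : Mat k) → T (RFstats prim n m p q M) →
    T (isRowFishburn M) × statsRF M ≡ (n , m , p , q) × T (primOK prim M)
  RFstats⁻ n m p q M h =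
    let f , h = T-∧⁻ {isRowFishburn M} h ; a , h = T-∧⁻ {size M ≡ᵇ n} h
        b , h = T-∧⁻ {maxStat M ≡ᵇ m} h ; c , h = T-∧⁻ {minStat M ≡ᵇ p} h ; d , h = T-∧⁻ {iso M ≡ᵇ q} h
    in f , Wt-≡ (≡ᵇ⇒≡ _ _ a) (≡ᵇ⇒≡ _ _ b) (≡ᵇ⇒≡ _ _ c) (≡ᵇ⇒≡ _ _ d) , h

  RFstats⁺ : ∀ n m p q {k} (M : Mat k) → T (isRowFishburn M) → statsRF M ≡ (n , m , p , q) →
    T (primOK prim M) → T (RFstats prim n m p q M)
  RFstats⁺ n m p q M f e h =
    T-∧⁺ f (T-∧⁺ (≡⇒≡ᵇ _ _ (cong deg e)) (T-∧⁺ (≡⇒≡ᵇ _ _ (cong st₂ e))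
      (T-∧⁺ (≡⇒≡ᵇ _ _ (cong st₃ e)) (T-∧⁺ (≡⇒≡ᵇ _ _ (cong st₄ e)) h))))

  RFlastCol⁻ : ∀ n m {k} (M : Mat k) → T (RFlastCol prim n m M) →
    T (isRowFishburn M) × lastColWt M ≡ (n , m , 0 , 0) × T (primOK prim M)
  RFlastCol⁻ n m M h =
    let f , h = T-∧⁻ {isRowFishburn M} h ; a , h = T-∧⁻ {size M ≡ᵇ n} h ; b , h = T-∧⁻ {lastColSum M ≡ᵇ m} h
    in f , Wt-≡ (≡ᵇ⇒≡ _ _ a) (≡ᵇ⇒≡ _ _ b) refl refl , h

  RFlastCol⁺ : ∀ n m {k} (M : Mat k) → T (isRowFishburn M) → lastColWt M ≡ (n , m , 0 , 0) →
    T (primOK prim M) → T (RFlastCol prim n m M)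
  RFlastCol⁺ n m M f e h = T-∧⁺ f (T-∧⁺ (≡⇒≡ᵇ _ _ (cong deg e)) (T-∧⁺ (≡⇒≡ᵇ _ _ (cong st₂ e)) h))

  SDdiag⁻ : ∀ n m (P : ∀ {k} → Mat k → Bool) {k} (M : Mat k) →
    T (isFishburn M ∧ isSelfDual M ∧ (rs M ≡ᵇ n) ∧ (lastColSum M ≡ᵇ m) ∧ P M ∧ primOK prim M) →
    T (isSelfDualFishburn M) × rs M ≡ n × lastColSum M ≡ m × T (P M) × T (primOK prim M)
  SDdiag⁻ n m P M h =
    let f , h = T-∧⁻ {isFishburn M} h ; s , h = T-∧⁻ {isSelfDual M} h ; a , h = T-∧⁻ {rs M ≡ᵇ n} h
        b , h = T-∧⁻ {lastColSum M ≡ᵇ m} h ; c , h = T-∧⁻ {P M} h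
    in T-∧⁺ f s , ≡ᵇ⇒≡ _ _ a , ≡ᵇ⇒≡ _ _ b , c , h

  SDdiag⁺ : ∀ n m (P : ∀ {k} → Mat k → Bool) {k} (M : Mat k) →
    T (isSelfDualFishburn M) → rs M ≡ n → lastColSum M ≡ m → T (P M) → T (primOK prim M) →
    T (isFishburn M ∧ isSelfDual M ∧ (rs M ≡ᵇ n) ∧ (lastColSum M ≡ᵇ m) ∧ P M ∧ primOK prim M)
  SDdiag⁺ n m P M f a b c h =
    let f , s = T-∧⁻ {isFishburn M} f in
    T-∧⁺ f (T-∧⁺ s (T-∧⁺ (≡⇒≡ᵇ _ _ a) (T-∧⁺ (≡⇒≡ᵇ _ _ b) (T-∧⁺ c h))))

  SDstats↔fibre : ∀ n m p q → 1 ≤ n + (p + q) → Family (SDstats prim n m p q) ↔ AllSD Y Q [ n , m , p , q ]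
  SDstats↔fibre n m p q 1≤ = ↔-trans
    (Family↔fibre prim (SDstats prim n m p q) isSelfDualFishburn statsSD _ (SDstats⁻ n m p q) (SDstats⁺ n m p q) (nonempty 1≤))
    (fibre-↔ (Σʷ-cong (mat≅SD prim)) _)
    where
    nonempty : ∀ {n m p q} → 1 ≤ n + (p + q) → ¬ (𝟘 ≡ (n , m , p , q))
    nonempty () refl

  RFstats↔fibre : ∀ n m p q → 1 ≤ p + q → Family (RFstats prim n m p q) ↔ AllRowF Y Q [ n , m , p , q ]
  RFstats↔fibre n m p q 1≤ = ↔-trans
    (Family↔fibre prim (RFstats prim n m p q) isRowFishburn statsRF _ (RFstats⁻ n m p q) (RFstats⁺ n m p q) (nonempty 1≤))
    (fibre-↔ (Σʷ-cong (mat≅RowF prim)) _)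
    where
    nonempty : ∀ {n m p q} → 1 ≤ p + q → ¬ (𝟘 ≡ (n , m , p , q))
    nonempty () refl

  RFlastCol↔fibre : ∀ n m → 1 ≤ n → Family (RFlastCol prim n m) ↔ AllRows Y [ n , m , 0 , 0 ]
  RFlastCol↔fibre n m 1≤ = ↔-trans
    (Family↔fibre prim (RFlastCol prim n m) isRowFishburn lastColWt _ (RFlastCol⁻ n m) (RFlastCol⁺ n m) (nonempty 1≤))
    (fibre-↔ (Σʷ-cong (λ k → mat≅Rows prim (suc k))) _)
    where
    nonempty : ∀ {n m} → 1 ≤ n → ¬ (𝟘 ≡ (n , m , 0 , 0))
    nonempty () refl

  -- B is built from X and Y only, so its last two statistics vanish; every weight with p + q at
  -- least 1 is left to R.
  AllRows-empty : ∀ n m p q → 1 ≤ p + q → ¬ AllRows Y [ n , m , p , q ]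
  AllRows-empty n m p q 1≤ ((j , a) , e) = m<n⇒n≢0 1≤ (sym (cong₂ _+_ (cong st₃ stats) (cong st₄ stats)))
    where
    stats : lastColWt (erase (proj₁ (from (mat≅Rows prim (suc j)) a))) ≡ (n , m , p , q)
    stats = trans (wt-to (≅-sym (mat≅Rows prim (suc j))) a) e

  -- In R the first row is nonzero and its sum is min + iso; weights with p = q = 0 are left to B.
  AllRowF-empty : ∀ n m → ¬ AllRowF Y Q [ n , m , 0 , 0 ]
  AllRowF-empty n m ((j , a) , e) = m<n⇒n≢0 (first-row-positive (erase V) V-rowFishburn) (cong₂ _+_ (cong st₃ stats) (cong st₄ stats))
    where
    V = proj₁ (from (mat≅RowF prim j) a)
    V-rowFishburn = proj₂ (from (mat≅RowF prim j) a)
    stats : statsRF (erase V) ≡ (n , m , 0 , 0)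
    stats = trans (wt-to (≅-sym (mat≅RowF prim j)) a) e

  SDstats↔RFstats : ∀ n m p q → 1 ≤ p + q → Family (SDstats prim n m p q) ↔ Family (RFstats prim n m p q)
  SDstats↔RFstats n m p q 1≤ = ↔-trans (SDstats↔fibre n m p q (≤-trans 1≤ (m≤n+m _ n)))
    (↔-trans (AllSD↔AllF Y Q _) (↔-trans (fibre-⊎ (AllRowF Y Q) (AllRows Y) _)
    (↔-trans (⊎-identityʳ-↔ (AllRows-empty n m p q 1≤)) (↔-sym (RFstats↔fibre n m p q 1≤)))))

  SDdiagZero↔SDstats : ∀ n m → Family (SDdiagZero prim n m) ↔ Family (SDstats prim n m 0 0)
  SDdiagZero↔SDstats n m = Σ-cong-↔ λ k → subset-↔ T-irrelevant T-irrelevant id id ⇒ ⇐ (λ _ _ → refl) (λ _ _ → refl)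
    where
    ⇒ : ∀ {k} (M : Mat k) → T (SDdiagZero prim n m M) → T (SDstats prim n m 0 0 M)
    ⇒ M h = let f , a , b , z , o = SDdiag⁻ n m allDiagZero M h
                iso≡0 = m+n≡0⇒n≡0 (dg M) (allDiagZero⇒ M z) in
      SDstats⁺ n m 0 0 M f (Wt-≡ a
        (trans (sym (+-identityʳ _)) (trans (cong (maxStat M +_) (sym iso≡0)) (trans (maxStat+iso M) b)))
        (m+n≡0⇒m≡0 (dg M) (allDiagZero⇒ M z)) iso≡0) o
    ⇐ : ∀ {k} (M : Mat k) → T (SDstats prim n m 0 0 M) → T (SDdiagZero prim n m M)
    ⇐ M h = let f , e , o = SDstats⁻ n m 0 0 M h in
      SDdiag⁺ n m allDiagZero M f (cong deg e)
        (trans (sym (maxStat+iso M)) (trans (cong₂ _+_ (cong st₂ e) (cong st₄ e)) (+-identityʳ m)))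
        (⇒allDiagZero M (cong₂ _+_ (cong st₃ e) (cong st₄ e))) o

  SDdiagZero↔RFlastCol : ∀ n m → 1 ≤ n → Family (SDdiagZero prim n m) ↔ Family (RFlastCol prim n m)
  SDdiagZero↔RFlastCol n m 1≤n = ↔-trans (SDdiagZero↔SDstats n m)
    (↔-trans (SDstats↔fibre n m 0 0 (≤-trans 1≤n (m≤m+n n _)))
    (↔-trans (AllSD↔AllF Y Q _) (↔-trans (fibre-⊎ (AllRowF Y Q) (AllRows Y) _)
    (↔-trans (⊎-identityˡ-↔ (AllRowF-empty n m)) (↔-sym (RFlastCol↔fibre n m 1≤n))))))

-- Sorting by max, dg or min, and iso

Parts : ℕ → Set
Parts m = Σ (ℕ × ℕ × ℕ) λ (m′ , p , q) → m′ + q ≡ m × 1 ≤ p + q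

-- The last column sum is max + iso, so fixing it at `m` leaves the choices in `Parts m`. The
-- condition on p + q expresses a nonzero diagonal on the self-dual side and a nonzero first row on
-- the other.
Family-by-stats : ∀ m (F : ∀ {k} → Mat k → Bool) (G : ℕ → ℕ → ℕ → ∀ {k} → Mat k → Bool)
  (st : ∀ {k} → Mat k → ℕ × ℕ × ℕ) →
  (∀ {k} (M : Mat k) → T (F M) → let (m′ , p , q) = st M in (m′ + q ≡ m × 1 ≤ p + q) × T (G m′ p q M)) →
  (∀ m′ p q {k} (M : Mat k) → m′ + q ≡ m × 1 ≤ p + q → T (G m′ p q M) → st M ≡ (m′ , p , q) × T (F M)) →
  Family F ↔ Σ (Parts m) λ ((m′ , p , q) , _) → Family (G m′ p q)
Family-by-stats m F G st F⇒ ⇒F = mk↔ₛ′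
  (λ (k , M , h) → (st M , proj₁ (F⇒ M h)) , k , M , proj₂ (F⇒ M h))
  (λ (((m′ , p , q) , c) , k , M , g) → k , M , proj₂ (⇒F m′ p q M c g))
  (λ (((m′ , p , q) , c) , k , M , g) → regroup m′ p q M c g (proj₁ (⇒F m′ p q M c g)) (F⇒ M (proj₂ (⇒F m′ p q M c g))))
  (λ (k , M , h) → cong (λ h → k , M , h) (T-irrelevant _ _))
  where
  -- The index is recomputed from the matrix and must agree with the given one; once it does, only
  -- proofs of propositions remain to be compared.
  regroup : ∀ m′ p q {k} (M : Mat k) c g → st M ≡ (m′ , p , q) → (x : (let (m′ , p , q) = st M in (m′ + q ≡ m × 1 ≤ p + q) × T (G m′ p q M))) →
    _≡_ {A = Σ (Parts m) λ ((m′ , p , q) , _) → Family (G m′ p q)} ((st M , proj₁ x) , k , M , proj₂ x) (((m′ , p , q) , c) , k , M , g)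
  regroup m′ p q {k} M (c₁ , c₂) g e ((d₁ , d₂) , g′) with st M
  regroup m′ p q {k} M (c₁ , c₂) g refl ((d₁ , d₂) , g′) | _ with ≡-irrelevant c₁ d₁ | ≤-irrelevant c₂ d₂ | T-irrelevant g g′
  ... | refl | refl | refl = refl

module _ (prim : Bool) where

  SDdiagNonzero↔ : ∀ n m → Family (SDdiagNonzero prim n m) ↔ Σ (Parts m) λ ((m′ , p , q) , _) → Family (SDstats prim n m′ p q)
  SDdiagNonzero↔ n m = Family-by-stats m (SDdiagNonzero prim n m) (SDstats prim n) (λ M → maxStat M , dg M , iso M)
    (λ M h → let f , a , b , z , o = SDdiag⁻ prim n m (λ M → not (allDiagZero M)) M h in
      (trans (maxStat+iso M) b , n≢0⇒n>0 (λ e → T-contra (⇒allDiagZero M e) z)) ,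
      SDstats⁺ prim n _ _ _ M f (cong (_, _) a) o)
    (λ m′ p q M (c , 1≤) g → let f , e , o = SDstats⁻ prim n m′ p q M g in
      cong proj₂ e , SDdiag⁺ prim n m (λ M → not (allDiagZero M)) M f (cong deg e)
        (trans (sym (maxStat+iso M)) (trans (cong₂ _+_ (cong st₂ e) (cong st₄ e)) c))
        (¬T⇒T-not λ z → m<n⇒n≢0 (subst (1 ≤_) (sym (cong₂ _+_ (cong st₃ e) (cong st₄ e))) 1≤) (allDiagZero⇒ M z)) o)
    where
    ¬T⇒T-not : ∀ {b} → ¬ T b → T (not b)
    ¬T⇒T-not = false⇒T-not ∘ ¬T⇒false

  RFlastCol↔ : ∀ n m → 1 ≤ n → Family (RFlastCol prim n m) ↔ Σ (Parts m) λ ((m′ , p , q) , _) → Family (RFstats prim n m′ p q)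
  RFlastCol↔ n m 1≤n = Family-by-stats m (RFlastCol prim n m) (RFstats prim n) (λ M → maxStat M , minStat M , iso M)
    (λ M h → let f , e , o = RFlastCol⁻ prim n m M h in
      (trans (maxStat+iso M) (cong st₂ e) , positive M (cong deg e) 1≤n f) ,
      RFstats⁺ prim n _ _ _ M f (cong (_, _) (cong deg e)) o)
    (λ m′ p q M (c , _) g → let f , e , o = RFstats⁻ prim n m′ p q M g in
      cong proj₂ e , RFlastCol⁺ prim n m M f (Wt-≡ (cong deg e)
        (trans (sym (maxStat+iso M)) (trans (cong₂ _+_ (cong st₂ e) (cong st₄ e)) c)) refl refl) o)
    where
    positive : ∀ {n k} (M : Mat k) → size M ≡ n → 1 ≤ n → T (isRowFishburn M) → 1 ≤ minStat M + iso M
    -- The empty matrix has no first row, but its size 0 contradicts `1 ≤ n`.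
    positive {k = zero}  [] refl ()
    positive {k = suc k} M  _ _ f = first-row-positive M f

  -- The refined equality is summed over `Parts m`. On the right this exhausts all row-Fishburn
  -- matrices, as their first row is never zero.
  SDdiagNonzero↔RFlastCol : ∀ n m → 1 ≤ n → Family (SDdiagNonzero prim n m) ↔ Family (RFlastCol prim n m)
  SDdiagNonzero↔RFlastCol n m 1≤n = ↔-trans (SDdiagNonzero↔ n m) (↔-trans
    (Σ-cong-↔ λ ((m′ , p , q) , _ , 1≤) → SDstats↔RFstats prim n m′ p q 1≤) (↔-sym (RFlastCol↔ n m 1≤n)))

theorem15 : (prim : Bool) →
    ((n m : ℕ) → 1 ≤ n → 1 ≤ m →
    (Family (SDdiagZero prim n m) ↔ Family (SDdiagNonzero prim n m))
    × (Family (SDdiagNonzero prim n m) ↔ Family (RFlastCol prim n m)))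
    × ((n m p q : ℕ) → 1 ≤ p + q →
    Family (SDstats prim n m p q) ↔ Family (RFstats prim n m p q))
theorem15 prim =
  (λ n m 1≤n _ → ↔-trans (SDdiagZero↔RFlastCol prim n m 1≤n) (↔-sym (SDdiagNonzero↔RFlastCol prim n m 1≤n))
    , SDdiagNonzero↔RFlastCol prim n m 1≤n)
  , SDstats↔RFstats prim
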